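{- Let $\mathcal{A}$ be a strongly connected $d$-dimensional VASS with at least one transition, and assume that on input $\mathcal{A}$ Algorithm 1 (described in the context) returns a tuple $(k,\mathit{tight})\in\mathbb{N}\times\{\mathit{true},\mathit{false}\}$. Then $k\in\{1,\dots,d\}$ and $\mathcal{L}(n)\in\Omega(n^k)$.
   Context: A $d$-dimensional VASS is a pair $\mathcal{A}=(Q,T)$ with $Q$ a finite nonempty set of states and $T\subseteq Q\times\mathbb{Z}^d\times Q$ a finite set of transitions such that every state has an outgoing transition. A configuration is $p\mathbf{v}$ with $p\in Q$, $\mathbf{v}\in\mathbb{N}^d$, of size $\max_i\mathbf{v}(i)$. A computation from $p_0\mathbf{v}_0$ is a sequence of configurations $p_0\mathbf{v}_0,\dots,p_n\mathbf{v}_n$ (vectors in $\mathbb{N}^d$) with transitions $(p_i,\mathbf{u}_{i+1},p_{i+1})\in T$ and $\mathbf{v}_{i+1}=\mathbf{v}_i+\mathbf{u}_{i+1}$; length $n$. $L(p\mathbf{v})\in\mathbb{N}\cup\{\infty\}$ is the least bound on lengths of computations from $p\mathbf{v}$; $\mathcal{L}(n)=\sup\{L(p\mathbf{v}):\text{size}(p\mathbf{v})=n\}$. $g\in\Omega(h)$ means $g(n)\ge b\,h(n)$ for some constant $b>0$ and all sufficiently large $n$. A sub-VASS is a VASS $(Q',T')$ with $Q'\subseteq Q$, $T'\subseteq T$; strongly connected means a nonempty path between any two states; an SCC of a graph $(Q,T')$ is a maximal strongly connected sub-VASS of it. A linear map is $f(p\mathbf{v})=\mathbf{c}_f^\top\mathbf{v}+\mathbf{w}_f(p)$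 with $\mathbf{c}_f\in\mathbb{Q}^d$, $\mathbf{w}_f\in\mathbb{Q}^Q$; a transition $(p,\mathbf{u},q)$ is $f$-ranked if $\mathbf{c}_f^\top\mathbf{u}+\mathbf{w}_f(q)\le\mathbf{w}_f(p)-1$ and $f$-neutral if $\mathbf{c}_f^\top\mathbf{u}+\mathbf{w}_f(q)=\mathbf{w}_f(p)$. A QRF is a linear map with $\mathbf{c}_f\ge\vec0$ such that every transition is $f$-ranked or $f$-neutral; positive if $\mathbf{c}_f>\vec0$. Algorithm 1: set $\mathit{tight}:=\mathit{true}$ iff a positive QRF for $\mathcal{A}$ exists; $k:=\mathrm{Decompose}(\mathcal{A})$; if $k=\infty$ return "non-terminating", else return $(k,\mathit{tight})$. $\mathrm{Decompose}(\mathcal{A})$: pick a QRF $f$ maximizing the number of $f$-ranked transitions; $T_f:=$ set of $f$-neutral transitions; if $T_f$ contains all transitions return $\infty$; if $T_f=\emptyset$ return $1$; otherwise with $\mathcal{A}_1,\dots,\mathcal{A}_\ell$ all SCCs of $(Q,T_f)$ return $1+\max_i\mathrm{Decompose}(\mathcal{A}_i)$. -}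

module Defs where

open import Data.Nat as ℕ using (ℕ; zero; suc; _⊔_; _^_)
open import Data.Integer as ℤ using (ℤ; +_)
open import Data.Rational as ℚ using (ℚ; 0ℚ; 1ℚ; _/_)
open import Data.Rational.Properties using (_≤?_; _≟_)
open import Data.Fin using (Fin)
open import Data.Fin.Subset using (Subset; _∈_; _⊆_; ∣_∣)
open import Data.Fin.Subset.Properties using (_∈?_)
open import Data.Vec using (tabulate)
import Data.Vec.Functional as VF
open import Data.Bool using (Bool; true; false)
open import Data.Maybe using (Maybe; just; nothing)
open import Data.Product using (Σ; ∃; _×_; _,_)
open import Data.Sum using (_⊎_)
open import Function.Definitions using (Injective)
open import Function.Bundles using (_⇔_)
open import Relation.Nullary using (¬_)
open import Relation.Nullary.Decidable using (⌊_⌋; _×-dec_)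
open import Relation.Binary.PropositionalEquality using (_≡_)

Vecℤ Vecℕ Vecℚ : ℕ → Set
Vecℤ d = Fin d → ℤ
Vecℕ d = Fin d → ℕ
Vecℚ d = Fin d → ℚ

ℕtoℚ : ℕ → ℚ
ℕtoℚ n = (+ n) / 1

ℤtoℚ : ℤ → ℚ
ℤtoℚ z = z / 1

dotℚℤ : ∀ {d} → Vecℚ d → Vecℤ d → ℚ
dotℚℤ c u = VF.foldr ℚ._+_ 0ℚ (λ i → c i ℚ.* ℤtoℚ (u i))

-- d-dimensional VASS.  States Q = Fin nQ (nonempty), transitions are
-- indexed by Fin nT; the map t ↦ (src t, upd t, tgt t) is injective, so
-- T is a genuine finite subset of Q × ℤ^d × Q.

record VASS (d : ℕ) : Set where
  field
    nQ      : ℕ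
    nT      : ℕ
    src     : Fin nT → Fin nQ
    upd     : Fin nT → Vecℤ d
    tgt     : Fin nT → Fin nQ
    trans-injective : Injective _≡_ _≡_ (λ t → (src t , upd t , tgt t))
    Q-nonempty      : Fin nQ
    outgoing        : (p : Fin nQ) → Σ (Fin nT) (λ t → src t ≡ p)

module _ {d : ℕ} (A : VASS d) where
  open VASS A

  size : Vecℕ d → ℕ
  size v = VF.foldr _⊔_ 0 v

  data Computation : Fin nQ → Vecℕ d → ℕ → Set where
    done : ∀ {p v} → Computation p v 0
    step : ∀ {p v n} (t : Fin nT) → src t ≡ p →
           (v′ : Vecℕ d) → (∀ i → + (v′ i) ≡ (+ (v i)) ℤ.+ upd t i) →
           Computation (tgt t) v′ n → Computation p v (suc n)

  -- "𝓛(n) ≥ x" for x ∈ ℚ.  𝓛(n) = sup over configurations of size n of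
  -- L(p v), and L(p v) ∈ ℕ ∪ {∞} is the least upper bound of the lengths
  -- of computations from p v; hence 𝓛(n) ≥ x holds iff some configuration
  -- of size n has a computation of length ≥ x.
  𝓛≥ : ℕ → ℚ → Set
  𝓛≥ n x = Σ (Fin nQ) λ p → Σ (Vecℕ d) λ v → size v ≡ n ×
           Σ ℕ λ m → Computation p v m × x ℚ.≤ ℕtoℚ m

  𝓛∈Ω[n^_] : ℕ → Set
  𝓛∈Ω[n^ k ] = Σ ℚ λ b → (0ℚ ℚ.< b) × Σ ℕ λ N →
               ∀ n → N ℕ.≤ n → 𝓛≥ n (b ℚ.* ℕtoℚ (n ^ k))

  record SubVASS : Set where
    constructor ⟨_,_⟩
    field
      states : Subset nQ
      transs : Subset nT
  open SubVASS public

  WellFormed : SubVASS → Set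
  WellFormed B = ∀ t → t ∈ transs B → src t ∈ states B × tgt t ∈ states B

  data Path (U : Subset nT) : Fin nQ → Fin nQ → Set where
    single : ∀ {p q} t → t ∈ U → src t ≡ p → tgt t ≡ q → Path U p q
    cons   : ∀ {p q} t → t ∈ U → src t ≡ p → Path U (tgt t) q → Path U p q

  StronglyConnected : SubVASS → Set
  StronglyConnected B =
    WellFormed B ×
    Σ (Fin nQ) (λ p → p ∈ states B) ×
    (∀ p q → p ∈ states B → q ∈ states B → Path (transs B) p q)

  IsSCC : Subset nQ → Subset nT → SubVASS → Set
  IsSCC S U C =
    states C ⊆ S × transs C ⊆ U × StronglyConnected C ×
    (∀ C′ → states C′ ⊆ S → transs C′ ⊆ U → StronglyConnected C′ →
       states C ⊆ states C′ → transs C ⊆ transs C′ →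
       (states C′ ≡ states C × transs C′ ≡ transs C))

  -- Linear maps f(p v) = c^T v + w(p) and quasi-ranking functions
  -- (w is given on all of Q; only its values on the states of the
  -- sub-VASS matter).

  record LinMap : Set where
    constructor lin
    field
      c : Vecℚ d
      w : Fin nQ → ℚ
  open LinMap public

  Ranked : LinMap → Fin nT → Set
  Ranked f t = dotℚℤ (c f) (upd t) ℚ.+ w f (tgt t) ℚ.≤ w f (src t) ℚ.- 1ℚ

  Neutral : LinMap → Fin nT → Set
  Neutral f t = dotℚℤ (c f) (upd t) ℚ.+ w f (tgt t) ≡ w f (src t)

  IsQRF : SubVASS → LinMap → Set
  IsQRF B f = (∀ i → 0ℚ ℚ.≤ c f i) ×
              (∀ t → t ∈ transs B → Ranked f t ⊎ Neutral f t)

  IsPositiveQRF : SubVASS → LinMap → Set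
  IsPositiveQRF B f = IsQRF B f × (∀ i → 0ℚ ℚ.< c f i)

  rankedSet : SubVASS → LinMap → Subset nT
  rankedSet B f = tabulate λ t →
    ⌊ (t ∈? transs B) ×-dec
      ((dotℚℤ (c f) (upd t) ℚ.+ w f (tgt t)) ≤? (w f (src t) ℚ.- 1ℚ)) ⌋

  neutralSet : SubVASS → LinMap → Subset nT
  neutralSet B f = tabulate λ t →
    ⌊ (t ∈? transs B) ×-dec
      ((dotℚℤ (c f) (upd t) ℚ.+ w f (tgt t)) ≟ w f (src t)) ⌋

  IsMaxQRF : SubVASS → LinMap → Set
  IsMaxQRF B f = IsQRF B f ×
    (∀ g → IsQRF B g → ∣ rankedSet B g ∣ ℕ.≤ ∣ rankedSet B f ∣)

  -- Decompose, as a relation (the choice of f is nondeterministic):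
  -- Decompose B r  means "some execution of Decompose(B) returns r",
  -- where r = just k  stands for k ∈ ℕ and r = nothing for ∞.

  data Decompose (B : SubVASS) : Maybe ℕ → Set where
    all-neutral : ∀ f → IsMaxQRF B f →
      neutralSet B f ≡ transs B →
      Decompose B nothing
    none-neutral : ∀ f → IsMaxQRF B f →
      ¬ (neutralSet B f ≡ transs B) →
      (∀ t → ¬ (t ∈ neutralSet B f)) →
      Decompose B (just 1)
    recurse-fin : ∀ f m → IsMaxQRF B f →
      ¬ (neutralSet B f ≡ transs B) →
      Σ (Fin nT) (λ t → t ∈ neutralSet B f) →
      (∀ C → IsSCC (states B) (neutralSet B f) C →
         Σ ℕ λ r → Decompose C (just r) × r ℕ.≤ m) →
      -- ... and m is attained (or there is no SCC and m = 0)
      (m ≡ 0 ⊎ Σ SubVASS λ C → IsSCC (states B) (neutralSet B f) C ×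
                                  Decompose C (just m)) →
      Decompose B (just (suc m))
    recurse-inf : ∀ f → IsMaxQRF B f →
      ¬ (neutralSet B f ≡ transs B) →
      Σ (Fin nT) (λ t → t ∈ neutralSet B f) →
      (∀ C → IsSCC (states B) (neutralSet B f) C →
         Σ (Maybe ℕ) λ r → Decompose C r) →
      (Σ SubVASS λ C → IsSCC (states B) (neutralSet B f) C ×
                         Decompose C nothing) →
      Decompose B nothing

  whole : SubVASS
  whole = ⟨ tabulate (λ _ → true) , tabulate (λ _ → true) ⟩

  -- Algorithm 1.  Algorithm1 r: some execution returns r, where
  -- r = nothing means "non-terminating" and r = just (k , tight) is a tuple.
  data Algorithm1 : Maybe (ℕ × Bool) → Set where
    nonterm : (tight : Bool) →
      (tight ≡ true ⇔ Σ LinMap (IsPositiveQRF whole)) →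
      Decompose whole nothing → Algorithm1 nothing
    result  : (tight : Bool) →
      (tight ≡ true ⇔ Σ LinMap (IsPositiveQRF whole)) →
      (k : ℕ) → Decompose whole (just k) → Algorithm1 (just (k , tight))

  IsStronglyConnectedVASS : Set
  IsStronglyConnectedVASS = StronglyConnected whole

{-# OPTIONS --safe #-}

-- Upper bound on k: every level of the decomposition contributes a QRF f and a closed
-- walk through an f-ranked transition.  The walks of later levels are f-neutral, so the
-- matrix of products (coefficients of f) · (effect of the walk) is triangular with nonzero
-- diagonal, and there are at most d levels.
--
-- Lower bound: by integer Farkas, each transition t that a maximal QRF leaves neutral lies
-- in a balanced multiset of transitions with nonnegative total effect; otherwise a
-- perturbed QRF would rank t as well.  Given closed walks W x in a sub-VASS C of the
-- neutral transitions of B, of length x^j, effect ≥ x · eff π and dip O(x), these multisets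
-- yield cycles in B whose x-fold repetition offsets x · eff π.  One round (W x, then each
-- cycle x times, joined by fixed connecting paths) costs only the fixed effect of these
-- paths, so it can be repeated x times within a dip O(x), which gives length x^(j+1).

module Submission where

open import Defs
open import Data.Nat using (ℕ; _≤_; NonZero)
open import Data.Bool using (Bool)
open import Data.Maybe using (just)
open import Data.Product using (_×_; _,_)

open import Algebra.Bundles using (CommutativeRing)
open import Data.Bool using (true; T)
open import Data.Fin as Fin using (Fin; zero; suc; _↑ˡ_; _↑ʳ_)
import Data.Fin.Properties as Fin
open import Data.Fin.Subset using (Subset; _∈_; _⊆_)
open import Data.Fin.Subset.Properties using (_∈?_; p⊂q⇒∣p∣<∣q∣; ⊆-antisym)
open import Data.Integer as ℤ using (ℤ; +_; 0ℤ; 1ℤ)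
import Data.Integer.Properties as ℤ
open import Data.Integer.Tactic.RingSolver using (solve-∀)
open import Data.List as List using (List; []; _∷_; [_]; _++_; length)
open import Data.List.Membership.Propositional using (find)
open import Data.List.Membership.Propositional.Properties using (∈-∃++)
import Data.List.Properties as List
open import Data.List.Relation.Binary.Permutation.Propositional as ↭ using (_↭_)
import Data.List.Relation.Binary.Permutation.Propositional.Properties as ↭
open import Data.List.Relation.Unary.All as All using (All; []; _∷_)
import Data.List.Relation.Unary.All.Properties as All
import Data.List.Relation.Unary.Any as Any
open import Data.Nat as ℕ using (zero; suc; z≤n; s≤s)
open import Data.Nat.DivMod using (_/_; m≡m%n+[m/n]*n; m%n≤n; m/n*n≤m; m≥n⇒m/n>0)
import Data.Nat.Properties as ℕ
open import Data.Nat.Tactic.RingSolver using () renaming (solve-∀ to ℕ-solve-∀)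
open import Data.Product using (∃-syntax; proj₁; proj₂)
open import Data.Rational as ℚ using (ℚ; 0ℚ; 1ℚ)
import Data.Rational.Properties as ℚ
open import Data.Rational.Solver using (module +-*-Solver)
import Data.Rational.Unnormalised as ℚᵘ
import Data.Rational.Unnormalised.Properties as ℚᵘ
open import Data.Sum using (_⊎_; inj₁; inj₂)
open import Data.Unit using (⊤; tt)
open import Data.Vec as Vec using (Vec; []; _∷_)
import Data.Vec.Functional as VF
import Data.Vec.Functional.Properties as VF
import Data.Vec.Properties as Vec
open import Data.Vec.Relation.Unary.All as AllV using ([]; _∷_) renaming (All to AllV)
import Data.Vec.Relation.Unary.All.Properties as AllV
open import Function using (_∘_)
open import Relation.Binary.PropositionalEquality using (_≡_; _≢_; _≗_; refl; sym; trans; cong; cong₂; subst; module ≡-Reasoning)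
open import Relation.Nullary using (¬_; Dec; yes; no; contradiction)
open import Relation.Nullary.Decidable using (⌊_⌋; toWitness; ¬?; _×-dec_; decidable-stable)

-- Arithmetic

0≤i*i : ∀ i → 0ℤ ℤ.≤ i ℤ.* i
0≤i*i (+ n)      = subst (0ℤ ℤ.≤_) (ℤ.pos-* n n) (ℤ.+≤+ z≤n)
0≤i*i ℤ.-[1+ n ] = ℤ.+≤+ z≤n

i≢0⇒0<i*i : ∀ {i} → i ≢ 0ℤ → 0ℤ ℤ.< i ℤ.* i
i≢0⇒0<i*i {+ zero}     i≢0 = contradiction refl i≢0
i≢0⇒0<i*i {+ suc n}    i≢0 = ℤ.+<+ (s≤s z≤n)
i≢0⇒0<i*i {ℤ.-[1+ n ]} i≢0 = ℤ.+<+ (s≤s z≤n)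

0<i*j : ∀ {i j} → 0ℤ ℤ.< i → 0ℤ ℤ.< j → 0ℤ ℤ.< i ℤ.* j
0<i*j {i} {j} 0<i 0<j =
  subst (ℤ._< i ℤ.* j) (ℤ.*-zeroʳ i) (ℤ.*-monoˡ-<-pos i {{ℤ.positive 0<i}} 0<j)

0≤i*j : ∀ {i j} → 0ℤ ℤ.≤ i → 0ℤ ℤ.≤ j → 0ℤ ℤ.≤ i ℤ.* j
0≤i*j {i} {j} 0≤i 0≤j =
  subst (ℤ._≤ i ℤ.* j) (ℤ.*-zeroʳ i) (ℤ.*-monoˡ-≤-nonNeg i {{ℤ.nonNegative 0≤i}} 0≤j)

p*q≢0 : ∀ {p q} → p ≢ 0ℚ → q ≢ 0ℚ → p ℚ.* q ≢ 0ℚ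
p*q≢0 {p} {q} p≢0 q≢0 pq≡0 = q≢0 (begin
  q                       ≡⟨ ℚ.*-identityˡ q ⟨
  1ℚ ℚ.* q                ≡⟨ cong (ℚ._* q) (ℚ.*-inverseˡ p) ⟨
  (ℚ.1/ p ℚ.* p) ℚ.* q    ≡⟨ ℚ.*-assoc (ℚ.1/ p) p q ⟩
  ℚ.1/ p ℚ.* (p ℚ.* q)    ≡⟨ cong (ℚ.1/ p ℚ.*_) pq≡0 ⟩
  ℚ.1/ p ℚ.* 0ℚ           ≡⟨ ℚ.*-zeroʳ (ℚ.1/ p) ⟩
  0ℚ                      ∎)
  where
  open ≡-Reasoning
  instance _ = ℚ.≢-nonZero p≢0

p-1<p : ∀ p → p ℚ.- 1ℚ ℚ.< p
p-1<p p = subst (p ℚ.- 1ℚ ℚ.<_) (ℚ.+-identityʳ p) (ℚ.+-monoʳ-< p (ℚ.negative⁻¹ (ℚ.- 1ℚ)))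

p≰p-1 : ∀ p → ¬ (p ℚ.≤ p ℚ.- 1ℚ)
p≰p-1 p p≤p-1 = ℚ.<-irrefl refl (ℚ.≤-<-trans p≤p-1 (p-1<p p))

ℤtoℚ-+ : ∀ i j → ℤtoℚ (i ℤ.+ j) ≡ ℤtoℚ i ℚ.+ ℤtoℚ j
ℤtoℚ-+ i j = ℚ.toℚᵘ-injective (begin
  ℚ.toℚᵘ (ℤtoℚ (i ℤ.+ j))                     ≈⟨ ℚ.toℚᵘ-fromℚᵘ (ℚᵘ.mkℚᵘ (i ℤ.+ j) 0) ⟩
  ℚᵘ.mkℚᵘ (i ℤ.+ j) 0                         ≈⟨ ℚᵘ.*≡* (unit i j) ⟩
  ℚᵘ.mkℚᵘ i 0 ℚᵘ.+ ℚᵘ.mkℚᵘ j 0                ≈⟨ ℚᵘ.+-cong (ℚ.toℚᵘ-fromℚᵘ (ℚᵘ.mkℚᵘ i 0)) (ℚ.toℚᵘ-fromℚᵘ (ℚᵘ.mkℚᵘ j 0)) ⟨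
  ℚ.toℚᵘ (ℤtoℚ i) ℚᵘ.+ ℚ.toℚᵘ (ℤtoℚ j)        ≈⟨ ℚ.toℚᵘ-homo-+ (ℤtoℚ i) (ℤtoℚ j) ⟨
  ℚ.toℚᵘ (ℤtoℚ i ℚ.+ ℤtoℚ j)                  ∎)
  where
  open import Relation.Binary.Reasoning.Setoid ℚᵘ.≃-setoid
  unit : ∀ i j → (i ℤ.+ j) ℤ.* 1ℤ ≡ (i ℤ.* 1ℤ ℤ.+ j ℤ.* 1ℤ) ℤ.* 1ℤ
  unit = solve-∀

ℤtoℚ-* : ∀ i j → ℤtoℚ (i ℤ.* j) ≡ ℤtoℚ i ℚ.* ℤtoℚ j
ℤtoℚ-* i j = ℚ.toℚᵘ-injective (begin
  ℚ.toℚᵘ (ℤtoℚ (i ℤ.* j))                     ≈⟨ ℚ.toℚᵘ-fromℚᵘ (ℚᵘ.mkℚᵘ (i ℤ.* j) 0) ⟩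
  ℚᵘ.mkℚᵘ i 0 ℚᵘ.* ℚᵘ.mkℚᵘ j 0                ≈⟨ ℚᵘ.*-cong (ℚ.toℚᵘ-fromℚᵘ (ℚᵘ.mkℚᵘ i 0)) (ℚ.toℚᵘ-fromℚᵘ (ℚᵘ.mkℚᵘ j 0)) ⟨
  ℚ.toℚᵘ (ℤtoℚ i) ℚᵘ.* ℚ.toℚᵘ (ℤtoℚ j)        ≈⟨ ℚ.toℚᵘ-homo-* (ℤtoℚ i) (ℤtoℚ j) ⟨
  ℚ.toℚᵘ (ℤtoℚ i ℚ.* ℤtoℚ j)                  ∎)
  where open import Relation.Binary.Reasoning.Setoid ℚᵘ.≃-setoid

ℤtoℚ-mono-≤ : ∀ {i j} → i ℤ.≤ j → ℤtoℚ i ℚ.≤ ℤtoℚ j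
ℤtoℚ-mono-≤ {i} {j} i≤j = ℚ.toℚᵘ-cancel-≤
  (ℚᵘ.≤-respˡ-≃ (ℚᵘ.≃-sym (ℚ.toℚᵘ-fromℚᵘ (ℚᵘ.mkℚᵘ i 0)))
    (ℚᵘ.≤-respʳ-≃ (ℚᵘ.≃-sym (ℚ.toℚᵘ-fromℚᵘ (ℚᵘ.mkℚᵘ j 0)))
      (ℚᵘ.*≤* (ℤ.*-monoʳ-≤-nonNeg 1ℤ i≤j))))

^-distribʳ-* : ∀ m n k → (m ℕ.* n) ℕ.^ k ≡ m ℕ.^ k ℕ.* n ℕ.^ k
^-distribʳ-* m n zero    = refl
^-distribʳ-* m n (suc k) = trans (cong (m ℕ.* n ℕ.*_) (^-distribʳ-* m n k)) (exchange m n (m ℕ.^ k) (n ℕ.^ k))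
  where
  exchange : ∀ a b c e → (a ℕ.* b) ℕ.* (c ℕ.* e) ≡ (a ℕ.* c) ℕ.* (b ℕ.* e)
  exchange = ℕ-solve-∀

-- The remainder is at most `c`, and one more `c` fits into `(n / c) * c` because the quotient is
-- positive. This turns a length bound in the rounded parameter `n / c` into one in `n`.
n≤2c[n/c] : ∀ c n .{{_ : NonZero c}} → c ≤ n → n ≤ (2 ℕ.* c) ℕ.* (n / c)
n≤2c[n/c] c n c≤n = begin
  n                                   ≡⟨ m≡m%n+[m/n]*n n c ⟩
  n ℕ.% c ℕ.+ (n / c) ℕ.* c           ≤⟨ ℕ.+-monoˡ-≤ ((n / c) ℕ.* c) (ℕ.≤-trans (m%n≤n n c) (ℕ.m≤n*m c (n / c) {{ℕ.>-nonZero (m≥n⇒m/n>0 c≤n)}})) ⟩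
  (n / c) ℕ.* c ℕ.+ (n / c) ℕ.* c     ≡⟨ double (n / c) c ⟩
  (2 ℕ.* c) ℕ.* (n / c)               ∎
  where
  open ℕ.≤-Reasoning
  double : ∀ x c → x ℕ.* c ℕ.+ x ℕ.* c ≡ (2 ℕ.* c) ℕ.* x
  double = ℕ-solve-∀

-- Supplies the rational constant of the Ω-bound from an estimate that stays in ℕ: `b` is `1 / D`.
reciprocal : ∀ D .{{_ : NonZero D}} →
             ∃[ b ] 0ℚ ℚ.< b × (∀ {n m} → n ≤ D ℕ.* m → b ℚ.* ℕtoℚ n ℚ.≤ ℕtoℚ m)
reciprocal D = b , ℚ.positive⁻¹ b , bound
  where
  instance
    D-pos : ℚ.Positive (ℕtoℚ D)
    D-pos = ℚ.normalize-pos D 1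
    D≢0 : ℚ.NonZero (ℕtoℚ D)
    D≢0 = ℚ.pos⇒nonZero (ℕtoℚ D)
  b = ℚ.1/ ℕtoℚ D
  instance
    b-pos : ℚ.Positive b
    b-pos = ℚ.1/pos⇒pos (ℕtoℚ D)
    b-nonNeg : ℚ.NonNegative b
    b-nonNeg = ℚ.pos⇒nonNeg b
  bound : ∀ {n m} → n ≤ D ℕ.* m → b ℚ.* ℕtoℚ n ℚ.≤ ℕtoℚ m
  bound {n} {m} n≤Dm = begin
    b ℚ.* ℕtoℚ n                  ≤⟨ ℚ.*-monoˡ-≤-nonNeg b (ℤtoℚ-mono-≤ (ℤ.+≤+ n≤Dm)) ⟩
    b ℚ.* ℕtoℚ (D ℕ.* m)          ≡⟨ cong (λ z → b ℚ.* ℤtoℚ z) (ℤ.pos-* D m) ⟩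
    b ℚ.* ℤtoℚ (+ D ℤ.* + m)      ≡⟨ cong (b ℚ.*_) (ℤtoℚ-* (+ D) (+ m)) ⟩
    b ℚ.* (ℕtoℚ D ℚ.* ℕtoℚ m)     ≡⟨ ℚ.*-assoc b (ℕtoℚ D) (ℕtoℚ m) ⟨
    (b ℚ.* ℕtoℚ D) ℚ.* ℕtoℚ m     ≡⟨ cong (ℚ._* ℕtoℚ m) (ℚ.*-inverseˡ (ℕtoℚ D)) ⟩
    1ℚ ℚ.* ℕtoℚ m                 ≡⟨ ℚ.*-identityˡ (ℕtoℚ m) ⟩
    ℕtoℚ m                        ∎
    where open ℚ.≤-Reasoning

-- Linear algebra

-- Generic in the ring because Farkas' lemma runs over ℤ and the elimination over ℚ. `dotℚℤ c u` is
-- definitionally `Dℚ.dot c (ℤtoℚ ∘ u)`.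
module DotProduct {a ℓ} (R : CommutativeRing a ℓ) where
  open CommutativeRing R renaming (trans to ≈-trans)
  open import Algebra.Properties.Semiring.Sum semiring public
  open import Relation.Binary.Reasoning.Setoid setoid

  dot : ∀ {n} → (Fin n → Carrier) → (Fin n → Carrier) → Carrier
  dot a x = sum (λ i → a i * x i)

  dot-comm : ∀ {n} (a x : Fin n → Carrier) → dot a x ≈ dot x a
  dot-comm a x = sum-cong-≋ (λ i → *-comm (a i) (x i))

  dot-linearˡ : ∀ {n} s r (a b x : Fin n → Carrier) →
                dot (λ i → s * a i + r * b i) x ≈ s * dot a x + r * dot b x
  dot-linearˡ s r a b x = begin
    sum (λ i → (s * a i + r * b i) * x i)
      ≈⟨ sum-cong-≋ (λ i → ≈-trans (distribʳ (x i) (s * a i) (r * b i))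
                             (+-cong (*-assoc s (a i) (x i)) (*-assoc r (b i) (x i)))) ⟩
    sum (λ i → s * (a i * x i) + r * (b i * x i))
      ≈⟨ ∑-distrib-+ (λ i → s * (a i * x i)) (λ i → r * (b i * x i)) ⟩
    sum (λ i → s * (a i * x i)) + sum (λ i → r * (b i * x i))
      ≈⟨ +-cong (*-distribˡ-sum s (λ i → a i * x i)) (*-distribˡ-sum r (λ i → b i * x i)) ⟨
    s * dot a x + r * dot b x ∎

  dot-linearʳ : ∀ {n} s r (a x y : Fin n → Carrier) →
                dot a (λ i → s * x i + r * y i) ≈ s * dot a x + r * dot a y
  dot-linearʳ s r a x y = begin
    dot a (λ i → s * x i + r * y i) ≈⟨ dot-comm a _ ⟩
    dot (λ i → s * x i + r * y i) a ≈⟨ dot-linearˡ s r x y a ⟩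
    s * dot x a + r * dot y a       ≈⟨ +-cong (*-congˡ (dot-comm x a)) (*-congˡ (dot-comm y a)) ⟩
    s * dot a x + r * dot a y       ∎

module Dℤ = DotProduct ℤ.+-*-commutativeRing
module Dℚ = DotProduct ℚ.+-*-commutativeRing

0≤dot-self : ∀ {n} (a : Fin n → ℤ) → 0ℤ ℤ.≤ Dℤ.dot a a
0≤dot-self {zero}  a = ℤ.≤-refl
0≤dot-self {suc n} a = ℤ.+-mono-≤ (0≤i*i (a zero)) (0≤dot-self (a ∘ suc))

0<dot-self : ∀ {n} (a : Fin n → ℤ) j → a j ≢ 0ℤ → 0ℤ ℤ.< Dℤ.dot a a
0<dot-self a zero    aⱼ≢0 = ℤ.+-mono-<-≤ (i≢0⇒0<i*i aⱼ≢0) (0≤dot-self (a ∘ suc))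
0<dot-self a (suc j) aⱼ≢0 = ℤ.+-mono-≤-< (0≤i*i (a zero)) (0<dot-self (a ∘ suc) j aⱼ≢0)

max-const : ∀ d n → VF.foldr ℕ._⊔_ 0 {suc d} (λ _ → n) ≡ n
max-const zero    n = ℕ.⊔-identityʳ n
max-const (suc d) n = trans (cong (n ℕ.⊔_) (max-const d n)) (ℕ.⊔-idem n)

entry≤max : ∀ {n} (v : Vecℕ n) i → v i ≤ VF.foldr ℕ._⊔_ 0 v
entry≤max v zero    = ℕ.m≤m⊔n (v zero) _
entry≤max v (suc i) = ℕ.≤-trans (entry≤max (v ∘ suc) i) (ℕ.m≤n⊔m (v zero) _)

-- The Kronecker delta, by recursion on both indices so that sums against it reduce by peeling off
-- heads.
ind : ∀ {n} → Fin n → Fin n → ℤ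
ind zero    zero    = 1ℤ
ind zero    (suc q) = 0ℤ
ind (suc p) zero    = 0ℤ
ind (suc p) (suc q) = ind p q

ind-refl : ∀ {n} (p : Fin n) → ind p p ≡ 1ℤ
ind-refl zero    = refl
ind-refl (suc p) = ind-refl p

ind-≢ : ∀ {n} {p q : Fin n} → p ≢ q → ind p q ≡ 0ℤ
ind-≢ {p = zero}  {zero}  p≢q = contradiction refl p≢q
ind-≢ {p = zero}  {suc q} p≢q = refl
ind-≢ {p = suc p} {zero}  p≢q = refl
ind-≢ {p = suc p} {suc q} p≢q = ind-≢ (p≢q ∘ cong suc)

0≤ind : ∀ {n} (p q : Fin n) → 0ℤ ℤ.≤ ind p q
0≤ind zero    zero    = ℤ.+≤+ z≤n
0≤ind zero    (suc q) = ℤ.+≤+ z≤n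
0≤ind (suc p) zero    = ℤ.+≤+ z≤n
0≤ind (suc p) (suc q) = 0≤ind p q

sum-split : ∀ m {n} (f : Fin (m ℕ.+ n) → ℤ) →
            Dℤ.sum f ≡ Dℤ.sum (λ i → f (i ↑ˡ n)) ℤ.+ Dℤ.sum (λ j → f (m ↑ʳ j))
sum-split zero    f = sym (ℤ.+-identityˡ _)
sum-split (suc m) f = trans (cong (λ z → f zero ℤ.+ z) (sum-split m (f ∘ suc)))
                            (sym (ℤ.+-assoc (f zero) _ _))

dot-++ : ∀ {m n} (a : Vecℤ m) (b : Vecℤ n) x →
         Dℤ.dot (a VF.++ b) x ≡ Dℤ.dot a (λ i → x (i ↑ˡ n)) ℤ.+ Dℤ.dot b (λ j → x (m ↑ʳ j))
dot-++ {m} {n} a b x = trans (sum-split m _) (cong₂ ℤ._+_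
  (Dℤ.sum-cong-≗ λ i → cong (ℤ._* x (i ↑ˡ n)) (VF.lookup-++ˡ a b i))
  (Dℤ.sum-cong-≗ λ j → cong (ℤ._* x (m ↑ʳ j)) (VF.lookup-++ʳ a b j)))

dot-zeroˡ : ∀ {n} (x : Vecℤ n) → Dℤ.dot (λ _ → 0ℤ) x ≡ 0ℤ
dot-zeroˡ {zero}  x = refl
dot-zeroˡ {suc n} x = trans (ℤ.+-identityˡ _) (dot-zeroˡ (x ∘ suc))

dot-ind : ∀ {n} (p : Fin n) (x : Vecℤ n) → Dℤ.dot (ind p) x ≡ x p
dot-ind zero    x = trans (cong₂ ℤ._+_ (ℤ.*-identityˡ (x zero)) (dot-zeroˡ (x ∘ suc))) (ℤ.+-identityʳ _)
dot-ind (suc p) x = trans (ℤ.+-identityˡ _) (dot-ind p (x ∘ suc))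

dot-ind-diff : ∀ {n} (p q : Fin n) (x : Vecℤ n) → Dℤ.dot (λ j → ind p j ℤ.- ind q j) x ≡ x p ℤ.- x q
dot-ind-diff p q x = begin
  Dℤ.dot (λ j → ind p j ℤ.- ind q j) x
    ≡⟨ Dℤ.sum-cong-≗ (λ j → cong (ℤ._* x j) (as-combination (ind p j) (ind q j))) ⟩
  Dℤ.dot (λ j → 1ℤ ℤ.* ind p j ℤ.+ ℤ.-1ℤ ℤ.* ind q j) x
    ≡⟨ Dℤ.dot-linearˡ 1ℤ ℤ.-1ℤ (ind p) (ind q) x ⟩
  1ℤ ℤ.* Dℤ.dot (ind p) x ℤ.+ ℤ.-1ℤ ℤ.* Dℤ.dot (ind q) x
    ≡⟨ cong₂ (λ y z → 1ℤ ℤ.* y ℤ.+ ℤ.-1ℤ ℤ.* z) (dot-ind p x) (dot-ind q x) ⟩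
  1ℤ ℤ.* x p ℤ.+ ℤ.-1ℤ ℤ.* x q
    ≡⟨ as-combination (x p) (x q) ⟨
  x p ℤ.- x q ∎
  where
  open ≡-Reasoning
  as-combination : ∀ a b → a ℤ.- b ≡ 1ℤ ℤ.* a ℤ.+ ℤ.-1ℤ ℤ.* b
  as-combination = solve-∀

dot-neg : ∀ {n} (a x : Vecℤ n) → Dℤ.dot (λ j → ℤ.- a j) x ≡ ℤ.- Dℤ.dot a x
dot-neg {zero}  a x = refl
dot-neg {suc n} a x = trans
  (cong₂ ℤ._+_ (sym (ℤ.neg-distribˡ-* (a zero) (x zero))) (dot-neg (a ∘ suc) (x ∘ suc)))
  (sym (ℤ.neg-distrib-+ (a zero ℤ.* x zero) _))

ℤtoℚ-sum : ∀ {n} (f : Fin n → ℤ) → ℤtoℚ (Dℤ.sum f) ≡ Dℚ.sum (ℤtoℚ ∘ f)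
ℤtoℚ-sum {zero}  f = refl
ℤtoℚ-sum {suc n} f =
  trans (ℤtoℚ-+ (f zero) (Dℤ.sum (f ∘ suc))) (cong (ℤtoℚ (f zero) ℚ.+_) (ℤtoℚ-sum (f ∘ suc)))

dotℚℤ-ℤtoℚ : ∀ {n} (c u : Vecℤ n) → dotℚℤ (ℤtoℚ ∘ c) u ≡ ℤtoℚ (Dℤ.dot c u)
dotℚℤ-ℤtoℚ c u = sym (trans (ℤtoℚ-sum (λ i → c i ℤ.* u i)) (Dℚ.sum-cong-≗ (λ i → ℤtoℚ-* (c i) (u i))))

dotℚℤ-0 : ∀ {n} (c : Vecℚ n) → dotℚℤ c (λ _ → 0ℤ) ≡ 0ℚ
dotℚℤ-0 {zero}  c = refl
dotℚℤ-0 {suc n} c = cong₂ ℚ._+_ (ℚ.*-zeroʳ (c zero)) (dotℚℤ-0 (c ∘ suc))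

dotℚℤ-+ : ∀ {n} (c : Vecℚ n) (u v : Vecℤ n) →
          dotℚℤ c (λ i → u i ℤ.+ v i) ≡ dotℚℤ c u ℚ.+ dotℚℤ c v
dotℚℤ-+ c u v = trans
  (Dℚ.sum-cong-≗ (λ i → trans (cong (c i ℚ.*_) (ℤtoℚ-+ (u i) (v i))) (ℚ.*-distribˡ-+ (c i) (ℤtoℚ (u i)) (ℤtoℚ (v i)))))
  (Dℚ.∑-distrib-+ (λ i → c i ℚ.* ℤtoℚ (u i)) (λ i → c i ℚ.* ℤtoℚ (v i)))

-- Farkas' lemma over ℤ

-- K stands for the cone of ℕ-combinations of the rows; it is not closed under
-- division, so only a positive multiple of γ can be placed in it.
module Farkas {N : ℕ} (K : (Fin N → ℤ) → Set)
  (K-resp : ∀ {u v} → u ≗ v → K u → K v)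
  (K-0 : K (λ _ → 0ℤ))
  (K-+ : ∀ {u v} → K u → K v → K (λ j → u j ℤ.+ v j)) where

  open Dℤ using (dot; dot-linearˡ; dot-linearʳ)

  K-*ℕ : ∀ n {v} → K v → K (λ j → + n ℤ.* v j)
  K-*ℕ zero    {v} k = K-resp (λ j → sym (ℤ.*-zeroˡ (v j))) K-0
  K-*ℕ (suc n) {v} k = K-resp (λ j → sym (ℤ.suc-* (+ n) (v j))) (K-+ k (K-*ℕ n k))

  K-* : ∀ {z v} → 0ℤ ℤ.≤ z → K v → K (λ j → z ℤ.* v j)
  K-* {+ n} _ = K-*ℕ n

  -- Bartl's induction on the number of rows: a separating point x′ for the other
  -- rows that fails for α is used to project everything along α.
  farkas : ∀ {m} (rows : Vec (Fin N → ℤ) m) → AllV K rows → (γ : Fin N → ℤ) →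
           (∃[ x ] AllV (λ a → dot a x ℤ.≤ 0ℤ) rows × 0ℤ ℤ.< dot γ x) ⊎
           (∃[ b ] 0ℤ ℤ.< b × K (λ j → b ℤ.* γ j))
  farkas [] [] γ with Fin.all? (λ j → γ j ℤ.≟ 0ℤ)
  ... | yes γ≡0 = inj₂ (1ℤ , ℤ.+<+ (s≤s z≤n) ,
                        K-resp (λ j → sym (trans (ℤ.*-identityˡ (γ j)) (γ≡0 j))) K-0)
  ... | no ¬γ≡0 with Fin.¬∀⟶∃¬ N (λ j → γ j ≡ 0ℤ) (λ j → γ j ℤ.≟ 0ℤ) ¬γ≡0
  ...   | j , γⱼ≢0 = inj₁ (γ , [] , 0<dot-self γ j γⱼ≢0)
  farkas (α ∷ rows) (kα ∷ ks) γ with farkas rows ks γ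
  ... | inj₂ cone = inj₂ cone
  ... | inj₁ (x′ , ax′≤0 , 0<γx′) with dot α x′ ℤ.≤? 0ℤ
  ...   | yes αx′≤0 = inj₁ (x′ , αx′≤0 ∷ ax′≤0 , 0<γx′)
  ...   | no αx′≰0 = lift (farkas (Vec.map proj rows) ks′ (proj γ))
    where
    s = dot α x′
    0<s : 0ℤ ℤ.< s
    0<s = ℤ.≰⇒> αx′≰0
    proj : (Fin N → ℤ) → (Fin N → ℤ)
    proj a j = s ℤ.* a j ℤ.+ (ℤ.- dot a x′) ℤ.* α j
    ks′ : AllV K (Vec.map proj rows)
    ks′ = AllV.map⁺ (AllV.map
      (λ (k , ax′≤0) → K-+ (K-* (ℤ.<⇒≤ 0<s) k) (K-* (ℤ.neg-mono-≤ ax′≤0) kα))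
      (AllV.zip (ks , ax′≤0)))
    -- The map from `x` to `s x - (α·x) x′` is adjoint to `proj` and its image is orthogonal to `α`,
    -- so a separating point of the projected system lifts to one for all rows.
    swap : ∀ x a → dot a (λ j → s ℤ.* x j ℤ.+ (ℤ.- dot α x) ℤ.* x′ j) ≡ dot (proj a) x
    swap x a = begin
      dot a (λ j → s ℤ.* x j ℤ.+ (ℤ.- dot α x) ℤ.* x′ j)
        ≡⟨ dot-linearʳ s (ℤ.- dot α x) a x x′ ⟩
      s ℤ.* dot a x ℤ.+ (ℤ.- dot α x) ℤ.* dot a x′
        ≡⟨ cong (λ z → s ℤ.* dot a x ℤ.+ z) (-ij≡-ji (dot α x) (dot a x′)) ⟩
      s ℤ.* dot a x ℤ.+ (ℤ.- dot a x′) ℤ.* dot α x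
        ≡⟨ dot-linearˡ s (ℤ.- dot a x′) a α x ⟨
      dot (proj a) x ∎
      where
      open ≡-Reasoning
      -ij≡-ji : ∀ i j → (ℤ.- i) ℤ.* j ≡ (ℤ.- j) ℤ.* i
      -ij≡-ji = solve-∀
    lift : (∃[ x ] AllV (λ a → dot a x ℤ.≤ 0ℤ) (Vec.map proj rows) × 0ℤ ℤ.< dot (proj γ) x) ⊎
           (∃[ b ] 0ℤ ℤ.< b × K (λ j → b ℤ.* proj γ j)) →
           (∃[ x ] AllV (λ a → dot a x ℤ.≤ 0ℤ) (α ∷ rows) × 0ℤ ℤ.< dot γ x) ⊎
           (∃[ b ] 0ℤ ℤ.< b × K (λ j → b ℤ.* γ j))
    lift (inj₁ (x , ax≤0 , 0<γx)) = inj₁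
      ( (λ j → s ℤ.* x j ℤ.+ (ℤ.- dot α x) ℤ.* x′ j)
      , ℤ.≤-reflexive (trans (dot-linearʳ s (ℤ.- dot α x) α x x′) (cancel s (dot α x)))
        ∷ AllV.map (λ {a} → subst (ℤ._≤ 0ℤ) (sym (swap x a))) (AllV.map⁻ ax≤0)
      , subst (0ℤ ℤ.<_) (sym (swap x γ)) 0<γx )
      where
      cancel : ∀ i j → i ℤ.* j ℤ.+ (ℤ.- j) ℤ.* i ≡ 0ℤ
      cancel = solve-∀
    -- `k` places `b (s γ - (γ·x′) α)` in the cone. Adding `b (γ·x′)` times `α`, a nonnegative
    -- multiple because `x′` separates `γ`, leaves `(b s) γ`.
    lift (inj₂ (b , 0<b , k)) = inj₂
      ( b ℤ.* s , 0<i*j 0<b 0<s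
      , K-resp (λ j → regroup b s (γ j) (dot γ x′) (α j))
               (K-+ k (K-* (0≤i*j (ℤ.<⇒≤ 0<b) (ℤ.<⇒≤ 0<γx′)) kα)) )
      where
      regroup : ∀ b s g r a → b ℤ.* (s ℤ.* g ℤ.+ (ℤ.- r) ℤ.* a) ℤ.+ (b ℤ.* r) ℤ.* a ≡ (b ℤ.* s) ℤ.* g
      regroup = solve-∀

-- Triangular systems over ℚ

_⟂_ : ∀ {d} → Vecℚ d → List (Vecℚ d × Vecℚ d) → Set
c ⟂ L = All (λ ce → Dℚ.dot c (proj₂ ce) ≡ 0ℚ) L

-- Only products of an earlier coefficient vector with a later effect must vanish: the matrix of all
-- products is lower triangular with nonzero diagonal.
data Triangular {d} : List (Vecℚ d × Vecℚ d) → Set where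
  []  : Triangular []
  _∷_ : ∀ {c e L} → Dℚ.dot c e ≢ 0ℚ × c ⟂ L → Triangular L → Triangular ((c , e) ∷ L)

dot-tail : ∀ {d} (c e : Vecℚ (suc d)) → c zero ≡ 0ℚ → Dℚ.dot (c ∘ suc) (e ∘ suc) ≡ Dℚ.dot c e
dot-tail c e c₀≡0 = begin
  Dℚ.dot (c ∘ suc) (e ∘ suc)                        ≡⟨ ℚ.+-identityˡ _ ⟨
  0ℚ ℚ.+ Dℚ.dot (c ∘ suc) (e ∘ suc)                 ≡⟨ cong (ℚ._+ Dℚ.dot (c ∘ suc) (e ∘ suc)) (ℚ.*-zeroˡ (e zero)) ⟨
  0ℚ ℚ.* e zero ℚ.+ Dℚ.dot (c ∘ suc) (e ∘ suc)      ≡⟨ cong (λ z → z ℚ.* e zero ℚ.+ Dℚ.dot (c ∘ suc) (e ∘ suc)) c₀≡0 ⟨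
  Dℚ.dot c e                                        ∎
  where open ≡-Reasoning

-- The first row with a nonzero head is the pivot: it is dropped and used to
-- clear the heads of the rows after it (those before it have head 0 already).
eliminate : ∀ {d} (L : List (Vecℚ (suc d) × Vecℚ (suc d))) → Triangular L →
            ∃[ L′ ] Triangular {d} L′ × length L ≤ suc (length L′) ×
                    (∀ c → c zero ≡ 0ℚ → c ⟂ L → (c ∘ suc) ⟂ L′)
eliminate [] [] = [] , [] , z≤n , λ _ _ _ → []
eliminate ((c , e) ∷ L) ((ce≢0 , c⟂L) ∷ tri) with c zero ℚ.≟ 0ℚ
... | yes c₀≡0 with eliminate L tri
-- A row with head 0 survives. The last clause of the statement, `perp`, is what keeps it orthogonal
-- to the reduced rows below it.
...   | L′ , tri′ , len , perp =
        (c ∘ suc , e ∘ suc) ∷ L′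
      , (subst (_≢ 0ℚ) (sym (dot-tail c e c₀≡0)) ce≢0 , perp c c₀≡0 c⟂L) ∷ tri′
      , s≤s len
      , λ { c′ c′₀≡0 (p ∷ ps) → trans (dot-tail c′ e c′₀≡0) p ∷ perp c′ c′₀≡0 ps }
eliminate {d} ((c , e) ∷ L) ((ce≢0 , c⟂L) ∷ tri) | no c₀≢0 =
    List.map reduce L , reduced L c⟂L tri
  , s≤s (ℕ.≤-reflexive (sym (List.length-map reduce L)))
  , λ { c′ c′₀≡0 (_ ∷ ps) → All.map⁺ (All.map (λ {ce} → trans (dot-tail c′ (proj₂ ce) c′₀≡0)) ps) }
  where
  clear : Vecℚ (suc d) → Vecℚ (suc d)
  clear c′ j = c zero ℚ.* c′ j ℚ.+ (ℚ.- c′ zero) ℚ.* c j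
  reduce : Vecℚ (suc d) × Vecℚ (suc d) → Vecℚ d × Vecℚ d
  reduce (c′ , e′) = clear c′ ∘ suc , e′ ∘ suc
  clear-zero : ∀ c′ → clear c′ zero ≡ 0ℚ
  clear-zero c′ = solve 2 (λ x y → x :* y :+ (:- y) :* x := con 0ℚ) refl (c zero) (c′ zero)
    where open +-*-Solver
  -- The pivot row is orthogonal to every later effect, so clearing a head merely scales the
  -- products by the nonzero pivot `c zero`.
  dot-reduce : ∀ c′ e′ → Dℚ.dot c e′ ≡ 0ℚ → Dℚ.dot (clear c′ ∘ suc) (e′ ∘ suc) ≡ c zero ℚ.* Dℚ.dot c′ e′
  dot-reduce c′ e′ ce′≡0 = begin
    Dℚ.dot (clear c′ ∘ suc) (e′ ∘ suc)                            ≡⟨ dot-tail (clear c′) e′ (clear-zero c′) ⟩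
    Dℚ.dot (clear c′) e′                                          ≡⟨ Dℚ.dot-linearˡ (c zero) (ℚ.- c′ zero) c′ c e′ ⟩
    c zero ℚ.* Dℚ.dot c′ e′ ℚ.+ (ℚ.- c′ zero) ℚ.* Dℚ.dot c e′        ≡⟨ cong (λ z → c zero ℚ.* Dℚ.dot c′ e′ ℚ.+ (ℚ.- c′ zero) ℚ.* z) ce′≡0 ⟩
    c zero ℚ.* Dℚ.dot c′ e′ ℚ.+ (ℚ.- c′ zero) ℚ.* 0ℚ              ≡⟨ cong ((c zero ℚ.* Dℚ.dot c′ e′) ℚ.+_) (ℚ.*-zeroʳ (ℚ.- c′ zero)) ⟩
    c zero ℚ.* Dℚ.dot c′ e′ ℚ.+ 0ℚ                                ≡⟨ ℚ.+-identityʳ _ ⟩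
    c zero ℚ.* Dℚ.dot c′ e′                                       ∎
    where open ≡-Reasoning
  reduced : ∀ M → c ⟂ M → Triangular M → Triangular (List.map reduce M)
  reduced [] _ [] = []
  reduced ((c′ , e′) ∷ M) (ce′≡0 ∷ c⟂M) ((c′e′≢0 , c′⟂M) ∷ tri′) =
    ( subst (_≢ 0ℚ) (sym (dot-reduce c′ e′ ce′≡0)) (p*q≢0 c₀≢0 c′e′≢0)
    , All.map⁺ (All.zipWith (λ {ce} (p , q) →
        trans (dot-reduce c′ (proj₂ ce) p) (trans (cong (c zero ℚ.*_) q) (ℚ.*-zeroʳ (c zero))))
        (c⟂M , c′⟂M)) )
    ∷ reduced M c⟂M tri′

-- Each elimination lowers the dimension by one and loses at most one row. In dimension 0 every
-- product is 0, so no diagonal entry can be nonzero.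
triangular-length : ∀ d (L : List (Vecℚ d × Vecℚ d)) → Triangular L → length L ≤ d
triangular-length zero    []      _                  = z≤n
triangular-length zero    (_ ∷ _) ((ce≢0 , _) ∷ _)   = contradiction refl ce≢0
triangular-length (suc d) L       tri                =
  let L′ , tri′ , len , _ = eliminate L tri
  in ℕ.≤-trans len (s≤s (triangular-length d L′ tri′))

-- Walks and their effects

module _ {n} {P : Fin n → Set} (P? : ∀ t → Dec (P t)) where

  ∈-tabulate⁺ : ∀ {t} → P t → t ∈ Vec.tabulate (λ t → ⌊ P? t ⌋)
  ∈-tabulate⁺ {t} p = Vec.lookup⇒[]= t _ (trans (Vec.lookup∘tabulate _ t) (isYes (P? t)))
    where
    isYes : (d : Dec (P t)) → ⌊ d ⌋ ≡ true
    isYes (yes _) = refl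
    isYes (no ¬p) = contradiction p ¬p

  ∈-tabulate⁻ : ∀ {t} → t ∈ Vec.tabulate (λ t → ⌊ P? t ⌋) → P t
  ∈-tabulate⁻ {t} t∈ = toWitness {a? = P? t}
    (subst T (sym (trans (sym (Vec.lookup∘tabulate _ t)) (Vec.[]=⇒lookup t∈))) tt)

module _ {X : Set} where

  total : (X → ℤ) → List X → ℤ
  total f []      = 0ℤ
  total f (t ∷ W) = f t ℤ.+ total f W

  total-++ : ∀ f V W → total f (V ++ W) ≡ total f V ℤ.+ total f W
  total-++ f []      W = sym (ℤ.+-identityˡ _)
  total-++ f (t ∷ V) W = trans (cong (λ z → f t ℤ.+ z) (total-++ f V W))
                               (sym (ℤ.+-assoc (f t) (total f V) (total f W)))

  total-↭ : ∀ f {V W} → V ↭ W → total f V ≡ total f W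
  total-↭ f ↭.refl          = refl
  total-↭ f (↭.prep x p)    = cong (λ z → f x ℤ.+ z) (total-↭ f p)
  total-↭ f (↭.swap {xs} {ys} x y p) =
    trans (exchange (f x) (f y) (total f xs)) (cong (λ z → f y ℤ.+ (f x ℤ.+ z)) (total-↭ f p))
    where
    exchange : ∀ a b c → a ℤ.+ (b ℤ.+ c) ≡ b ℤ.+ (a ℤ.+ c)
    exchange = solve-∀
  total-↭ f (↭.trans p q)   = trans (total-↭ f p) (total-↭ f q)

  0≤total : ∀ {f W} → All (λ t → 0ℤ ℤ.≤ f t) W → 0ℤ ℤ.≤ total f W
  0≤total []       = ℤ.≤-refl
  0≤total (p ∷ ps) = ℤ.+-mono-≤ p (0≤total ps)

  copies : ℕ → List X → List X
  copies zero    W = []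
  copies (suc n) W = W ++ copies n W

  total-copies : ∀ f n W → total f (copies n W) ≡ + n ℤ.* total f W
  total-copies f zero    W = refl
  total-copies f (suc n) W = begin
    total f (W ++ copies n W)             ≡⟨ total-++ f W (copies n W) ⟩
    total f W ℤ.+ total f (copies n W)    ≡⟨ cong (λ z → total f W ℤ.+ z) (total-copies f n W) ⟩
    total f W ℤ.+ + n ℤ.* total f W       ≡⟨ ℤ.suc-* (+ n) (total f W) ⟨
    + suc n ℤ.* total f W                 ∎
    where open ≡-Reasoning

  length-copies : ∀ n W → length (copies n W) ≡ n ℕ.* length W
  length-copies zero    W = refl
  length-copies (suc n) W =
    trans (List.length-++ W) (cong (length W ℕ.+_) (length-copies n W))

module Walks {d : ℕ} (A : VASS d) where
  open VASS A

  Trans : Set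
  Trans = Fin nT

  eff : List Trans → Vecℤ d
  eff W i = total (λ t → upd t i) W

  -- The column of the incidence matrix of the control graph that belongs to `t`. Vanishing of
  -- `bal R` is Kirchhoff's law for the multiset `R`.
  flow : Trans → Fin nQ → ℤ
  flow t q = ind (tgt t) q ℤ.- ind (src t) q

  bal : List Trans → Fin nQ → ℤ
  bal W q = total (λ t → flow t q) W

  data Walk (U : Subset nT) : Fin nQ → List Trans → Fin nQ → Set where
    []  : ∀ {p} → Walk U p [] p
    _∷_ : ∀ {t W q} → t ∈ U → Walk U (tgt t) W q → Walk U (src t) (t ∷ W) q

  module _ {U : Subset nT} where

    walk-++ : ∀ {p q r V W} → Walk U p V q → Walk U q W r → Walk U p (V ++ W) r
    walk-++ []        ws = ws
    walk-++ (t∈U ∷ vs) ws = t∈U ∷ walk-++ vs ws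

    walk-copies : ∀ {p W} n → Walk U p W p → Walk U p (copies n W) p
    walk-copies zero    ws = []
    walk-copies (suc n) ws = walk-++ ws (walk-copies n ws)

    walk-all : ∀ {p W q} → Walk U p W q → All (_∈ U) W
    walk-all []         = []
    walk-all (t∈U ∷ ws) = t∈U ∷ walk-all ws

    walk-bal : ∀ {p W q} → Walk U p W q → ∀ z → bal W z ≡ ind q z ℤ.- ind p z
    walk-bal {p} []                       z = sym (ℤ.+-inverseʳ (ind p z))
    walk-bal {q = q} (_∷_ {t = t} t∈U ws) z =
      trans (cong (λ x → flow t z ℤ.+ x) (walk-bal ws z))
            (telescope (ind (tgt t) z) (ind (src t) z) (ind q z))
      where
      telescope : ∀ a b c → (a ℤ.- b) ℤ.+ (c ℤ.- a) ≡ c ℤ.- b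
      telescope = solve-∀

    path⇒walk : ∀ {p q} → Path A U p q → ∃[ W ] Walk U p W q × 1 ≤ length W
    path⇒walk (single t t∈U refl refl) = t ∷ [] , t∈U ∷ [] , s≤s z≤n
    path⇒walk (cons t t∈U refl path)   =
      let W , ws , _ = path⇒walk path in t ∷ W , t∈U ∷ ws , s≤s z≤n

  walk-mono : ∀ {U V p W q} → U ⊆ V → Walk U p W q → Walk V p W q
  walk-mono U⊆V []         = []
  walk-mono U⊆V (t∈U ∷ ws) = U⊆V t∈U ∷ walk-mono U⊆V ws

  -- Nonnegative execution of walks and the depth of their dips

  Safe : Vecℤ d → List Trans → Set
  Safe v []      = ⊤
  Safe v (t ∷ W) = (∀ i → 0ℤ ℤ.≤ v i ℤ.+ upd t i) × Safe (λ i → v i ℤ.+ upd t i) W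

  -- Besides monotonicity this is the transport between pointwise equal starting vectors, used with
  -- `ℤ.≤-reflexive`.
  safe-mono : ∀ {u v} → (∀ i → u i ℤ.≤ v i) → ∀ W → Safe u W → Safe v W
  safe-mono u≤v []      _          = tt
  safe-mono u≤v (t ∷ W) (0≤ , safe) =
    (λ i → ℤ.≤-trans (0≤ i) (ℤ.+-monoˡ-≤ (upd t i) (u≤v i))) ,
    safe-mono (λ i → ℤ.+-monoˡ-≤ (upd t i) (u≤v i)) W safe

  safe-++ : ∀ {v} V W → Safe v V → Safe (λ i → v i ℤ.+ eff V i) W → Safe v (V ++ W)
  safe-++ {v} []      W _           safe = safe-mono (λ i → ℤ.≤-reflexive (ℤ.+-identityʳ (v i))) W safe
  safe-++ {v} (t ∷ V) W (0≤ , safe) safe′ =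
    0≤ , safe-++ V W safe
           (safe-mono (λ i → ℤ.≤-reflexive (sym (ℤ.+-assoc (v i) (upd t i) (eff V i)))) W safe′)

  safe-end : ∀ {v} → (∀ i → 0ℤ ℤ.≤ v i) → ∀ W → Safe v W → ∀ i → 0ℤ ℤ.≤ v i ℤ.+ eff W i
  safe-end {v} 0≤v []      _           i = subst (0ℤ ℤ.≤_) (sym (ℤ.+-identityʳ (v i))) (0≤v i)
  safe-end {v} 0≤v (t ∷ W) (0≤ , safe) i =
    subst (0ℤ ℤ.≤_) (ℤ.+-assoc (v i) (upd t i) (eff W i)) (safe-end 0≤ W safe i)

  Dip : ℕ → List Trans → Set
  Dip m W = ∀ v → (∀ i → + m ℤ.≤ v i) → Safe v W

  dip-mono : ∀ {m n} → m ≤ n → ∀ {W} → Dip m W → Dip n W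
  dip-mono m≤n dip v n≤v = dip v (λ i → ℤ.≤-trans (ℤ.+≤+ m≤n) (n≤v i))

  -- Started with `m` in every counter, the walk ends with `m + eff W i`, which is nonnegative.
  dip-eff : ∀ {m W} → Dip m W → ∀ i → ℤ.- + m ℤ.≤ eff W i
  dip-eff {m} {W} dip i = begin
    ℤ.- + m                              ≡⟨ ℤ.+-identityʳ (ℤ.- + m) ⟨
    ℤ.- + m ℤ.+ 0ℤ                       ≤⟨ ℤ.+-monoʳ-≤ (ℤ.- + m) 0≤end ⟩
    ℤ.- + m ℤ.+ (+ m ℤ.+ eff W i)        ≡⟨ cancel (+ m) (eff W i) ⟩
    eff W i                              ∎
    where
    open ℤ.≤-Reasoning
    0≤end : 0ℤ ℤ.≤ + m ℤ.+ eff W i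
    0≤end = safe-end (λ _ → ℤ.+≤+ z≤n) W (dip (λ _ → + m) (λ _ → ℤ.≤-refl)) i
    cancel : ∀ a b → ℤ.- a ℤ.+ (a ℤ.+ b) ≡ b
    cancel = solve-∀

  -- The transient dip `m` of `V` is kept apart from its net loss `e`: only the net loss is added to
  -- what `W` requires.
  dip-then : ∀ {m n e V W} → Dip m V → (∀ i → ℤ.- + e ℤ.≤ eff V i) → m ≤ n ℕ.+ e →
             Dip n W → Dip (n ℕ.+ e) (V ++ W)
  dip-then {m} {n} {e} {V} {W} dipV -e≤V m≤n+e dipW v n+e≤v =
    safe-++ V W (dip-mono m≤n+e dipV v n+e≤v) (dipW _ λ i → begin
      + n                              ≡⟨ cancel (+ n) (+ e) ⟨
      (+ n ℤ.+ + e) ℤ.+ ℤ.- + e        ≤⟨ ℤ.+-mono-≤ (n+e≤v i) (-e≤V i) ⟩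
      v i ℤ.+ eff V i                  ∎)
    where
    open ℤ.≤-Reasoning
    cancel : ∀ a b → (a ℤ.+ b) ℤ.+ ℤ.- b ≡ a
    cancel = solve-∀

  dip-++ : ∀ {m n V W} → Dip m V → Dip n W → Dip (m ℕ.+ n) (V ++ W)
  dip-++ {m} {n} {V} {W} dipV dipW = subst (λ k → Dip k (V ++ W)) (ℕ.+-comm n m)
    (dip-then dipV (dip-eff dipV) (ℕ.m≤n+m m n) dipW)

  -- The transient dip is paid once and only the net loss accumulates. A round of dip O(x) with
  -- bounded net loss can therefore be repeated `x` times within a dip O(x).
  dip-copies : ∀ {m e W} → Dip m W → (∀ i → ℤ.- + e ℤ.≤ eff W i) →
               ∀ n → Dip (m ℕ.+ e ℕ.* n) (copies n W)
  dip-copies dip -e≤W zero    = λ _ _ → tt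
  dip-copies {m} {e} {W} dip -e≤W (suc n) = subst (λ k → Dip k (copies (suc n) W)) eq
    (dip-then dip -e≤W (ℕ.≤-trans (ℕ.m≤m+n m (e ℕ.* n)) (ℕ.m≤m+n _ e)) (dip-copies dip -e≤W n))
    where
    eq : m ℕ.+ e ℕ.* n ℕ.+ e ≡ m ℕ.+ e ℕ.* suc n
    eq = trans (ℕ.+-assoc m (e ℕ.* n) e)
               (cong (m ℕ.+_) (trans (ℕ.+-comm (e ℕ.* n) e) (sym (ℕ.*-suc e n))))

  -- The cruder estimate, charging the full dip to every copy; it suffices for walks that do not
  -- depend on `x`.
  dip-copies-* : ∀ {m W} → Dip m W → ∀ n → Dip (m ℕ.* n) (copies n W)
  dip-copies-* dip zero    = λ _ _ → tt
  dip-copies-* {m} {W} dip (suc n) = subst (λ k → Dip k (copies (suc n) W)) (sym (ℕ.*-suc m n))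
    (dip-++ dip (dip-copies-* dip n))

  drop : List Trans → ℕ
  drop []      = 0
  drop (t ∷ W) = size A (λ i → ℤ.∣ upd t i ∣) ℕ.+ drop W

  dip-drop : ∀ W → Dip (drop W) W
  dip-drop []      = λ _ _ → tt
  dip-drop (t ∷ W) = dip-++ {V = [ t ]} (λ v s≤v → (λ i → begin
      0ℤ                                   ≤⟨ 0≤∣i∣+i (upd t i) ⟩
      + ℤ.∣ upd t i ∣ ℤ.+ upd t i          ≤⟨ ℤ.+-monoˡ-≤ (upd t i) (ℤ.≤-trans (ℤ.+≤+ (entry≤max (λ i → ℤ.∣ upd t i ∣) i)) (s≤v i)) ⟩
      v i ℤ.+ upd t i                      ∎) , tt) (dip-drop W)
    where
    open ℤ.≤-Reasoning
    0≤∣i∣+i : ∀ i → 0ℤ ℤ.≤ + ℤ.∣ i ∣ ℤ.+ i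
    0≤∣i∣+i (+ n)      = ℤ.+≤+ z≤n
    0≤∣i∣+i ℤ.-[1+ n ] = ℤ.≤-reflexive (sym (ℤ.+-inverseʳ (+ suc n)))

  -- Extraction of walks from multisets of transitions

  -- A transition that does not start at `q` contributes a nonnegative amount to the balance at `q`,
  -- so a negative balance needs one that does.
  leaving : ∀ q R → bal R q ℤ.< 0ℤ → ∃[ t ] ∃[ R′ ] src t ≡ q × R ↭ t ∷ R′
  leaving q R bal<0 with Any.any? (λ t → src t Fin.≟ q) R
  ... | no ∄t = contradiction (0≤total (All.map 0≤flow (All.¬Any⇒All¬ R ∄t))) (ℤ.<⇒≱ bal<0)
    where
    0≤flow : ∀ {t} → src t ≢ q → 0ℤ ℤ.≤ flow t q
    0≤flow {t} src≢q rewrite ind-≢ src≢q =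
      subst (0ℤ ℤ.≤_) (sym (ℤ.+-identityʳ (ind (tgt t) q))) (0≤ind (tgt t) q)
  ... | yes ∃t with find ∃t
  ...   | t , t∈R , src≡q with ∈-∃++ t∈R
  ...     | R₁ , R₂ , refl = t , R₁ ++ R₂ , src≡q , ↭.shift t R₁ R₂

  -- Euler's argument: as long as `q` differs from `p`, the balance at `q` is -1, so some transition
  -- of `R` leaves `q`. Following it moves `q` to its target and preserves the form of the balance;
  -- `n` bounds the number of transitions left.
  closeUp : ∀ {U} n R → length R ≤ n → All (_∈ U) R → ∀ p q →
            (∀ z → bal R z ≡ ind p z ℤ.- ind q z) →
            ∃[ W ] ∃[ R′ ] Walk U q W p × R ↭ W ++ R′
  closeUp n R len R⊆U p q balR with p Fin.≟ q
  ... | yes refl = [] , R , [] , ↭.refl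
  ... | no p≢q with leaving q R (subst (ℤ._< 0ℤ) (sym balR≡-1) ℤ.-<+)
    where
    balR≡-1 : bal R q ≡ ℤ.-1ℤ
    balR≡-1 = trans (balR q) (cong₂ ℤ._-_ (ind-≢ p≢q) (ind-refl q))
  closeUp zero    R  len R⊆U p q balR | no p≢q | t , R₁ , refl , R↭ =
    contradiction (subst (_≤ 0) (↭.↭-length R↭) len) λ ()
  closeUp (suc n) R  len R⊆U p q balR | no p≢q | t , R₁ , refl , R↭ =
    let W , R′ , ws , R₁↭ = closeUp n R₁ len₁ (All.tail tR₁⊆U) p (tgt t) balR₁
    in t ∷ W , R′ , All.head tR₁⊆U ∷ ws , ↭.trans R↭ (↭.prep t R₁↭)
    where
    tR₁⊆U = ↭.All-resp-↭ R↭ R⊆U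
    len₁ : length R₁ ≤ n
    len₁ = ℕ.s≤s⁻¹ (subst (_≤ suc n) (↭.↭-length R↭) len)
    balR₁ : ∀ z → bal R₁ z ≡ ind p z ℤ.- ind (tgt t) z
    balR₁ z = begin
      bal R₁ z                                   ≡⟨ isolate (flow t z) (bal R₁ z) ⟩
      (flow t z ℤ.+ bal R₁ z) ℤ.- flow t z       ≡⟨ cong (ℤ._- flow t z) (trans (sym (total-↭ _ R↭)) (balR z)) ⟩
      (ind p z ℤ.- ind (src t) z) ℤ.- flow t z   ≡⟨ simplify (ind p z) (ind (src t) z) (ind (tgt t) z) ⟩
      ind p z ℤ.- ind (tgt t) z                  ∎
      where
      open ≡-Reasoning
      isolate : ∀ a b → b ≡ (a ℤ.+ b) ℤ.- a
      isolate = solve-∀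
      simplify : ∀ a b c → (a ℤ.- b) ℤ.- (c ℤ.- b) ≡ a ℤ.- c
      simplify = solve-∀

-- Pumping

module Pumping {d : ℕ} (A : VASS d) where
  open VASS A
  open Walks A

  -- W x runs cycles of total effect a, each x times; σ joins the connecting paths.
  record Family (U : Subset nT) (p : Fin nQ) (a : Vecℤ d) : Set where
    field
      σ        : List Trans
      σ-closed : Walk U p σ p
      W        : ℕ → List Trans
      W-closed : ∀ x → Walk U p (W x) p
      rate     : ℕ
      W-dip    : ∀ x → 1 ≤ x → Dip (rate ℕ.* x) (W x)
      W-eff    : ∀ x i → eff (W x) i ≡ + x ℤ.* a i ℤ.+ eff σ i

  -- `W x` is compared with `x` copies of one fixed closed walk `π`. Whatever offsets `π` thus
  -- offsets `W x` when taken `x` times, although `W x` may be much longer than `x` copies of `π`.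
  record Pump (B : SubVASS A) (j : ℕ) : Set where
    field
      base     : Fin nQ
      base∈    : base ∈ states B
      π        : List Trans
      π-closed : Walk (transs B) base π base
      W        : ℕ → List Trans
      W-closed : ∀ x → Walk (transs B) base (W x) base
      rate     : ℕ
      W-dip    : ∀ x → 1 ≤ x → Dip (rate ℕ.* x) (W x)
      W-eff    : ∀ x i → + x ℤ.* eff π i ℤ.≤ eff (W x) i
      W-length : ∀ x → x ℕ.^ j ≤ length (W x)

  -- Stated through counts alone: `R` is a multiset and need not be connected. Cycles are formed
  -- from it, and joined, only in `family`.
  Compensated : Subset nT → List Trans → Set
  Compensated U V = ∃[ R ] All (_∈ U) R × (∀ z → bal V z ℤ.+ bal R z ≡ 0ℤ) ×
                         (∀ i → 0ℤ ℤ.≤ eff V i ℤ.+ eff R i)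

  compensate : ∀ {U V} → All (λ t → Compensated U [ t ]) V → Compensated U V
  compensate []                              = [] , [] , (λ _ → refl) , λ _ → ℤ.≤-refl
  compensate {V = t ∷ V} ((R , R⊆U , balR , effR) ∷ ps) =
    let S , S⊆U , balS , effS = compensate ps in
    R ++ S , All.++⁺ R⊆U S⊆U ,
    (λ z → trans (merge (λ t → flow t z) S) (cong₂ ℤ._+_ (balR z) (balS z))) ,
    λ i → subst (0ℤ ℤ.≤_) (sym (merge (λ t → upd t i) S)) (ℤ.+-mono-≤ (effR i) (effS i))
    where
    regroup : ∀ a b c e → (a ℤ.+ b) ℤ.+ (c ℤ.+ e) ≡ ((a ℤ.+ 0ℤ) ℤ.+ c) ℤ.+ (b ℤ.+ e)
    regroup = solve-∀
    merge : ∀ f S → total f (t ∷ V) ℤ.+ total f (R ++ S) ≡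
                    (total f [ t ] ℤ.+ total f R) ℤ.+ (total f V ℤ.+ total f S)
    merge f S = trans (cong (λ z → total f (t ∷ V) ℤ.+ z) (total-++ f R S))
                      (regroup (f t) (total f V) (total f R) (total f S))

  module _ {B : SubVASS A} (sc : StronglyConnected A B) where
    private U = transs B

    connect : ∀ {p q} → p ∈ states B → q ∈ states B → ∃[ W ] Walk U p W q × 1 ≤ length W
    connect p∈B q∈B = path⇒walk (proj₂ (proj₂ sc) _ _ p∈B q∈B)

    Family-[] : ∀ {p} → Family U p (eff [])
    Family-[] = record
      { σ = [] ; σ-closed = [] ; W = λ _ → [] ; W-closed = λ _ → [] ; rate = 0
      ; W-dip = λ _ _ _ _ → tt ; W-eff = λ x i → sym (trans (ℤ.+-identityʳ _) (ℤ.*-zeroʳ (+ x))) }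

    -- The new cycle need not pass through `p`. It is reached by a detour `go`, `back` that is
    -- walked once whatever `x` is, so the detour enters `σ` while the cycle enters the effect
    -- scaled by `x`.
    Family-cycle : ∀ {p} t Z R → p ∈ states B → Walk U (src t) (t ∷ Z) (src t) →
                   Family U p (eff R) → Family U p (eff (t ∷ Z ++ R))
    Family-cycle {p} t Z R p∈B cycle@(t∈U ∷ _) F = record
      { σ        = (go ++ back) ++ F.σ
      ; σ-closed = walk-++ (walk-++ goes comes) F.σ-closed
      ; W        = λ x → (go ++ (copies x (t ∷ Z) ++ back)) ++ F.W x
      ; W-closed = λ x → walk-++ (walk-++ goes (walk-++ (walk-copies x cycle) comes)) (F.W-closed x)
      ; rate     = (drop go ℕ.+ (drop (t ∷ Z) ℕ.+ drop back)) ℕ.+ F.rate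
      ; W-dip    = dips
      ; W-eff    = effs
      }
      where
      module F = Family F
      src∈B = proj₁ (proj₁ sc t t∈U)
      go    = proj₁ (connect p∈B src∈B)
      goes  = proj₁ (proj₂ (connect p∈B src∈B))
      back  = proj₁ (connect src∈B p∈B)
      comes = proj₁ (proj₂ (connect src∈B p∈B))
      dips : ∀ x → 1 ≤ x → Dip (((drop go ℕ.+ (drop (t ∷ Z) ℕ.+ drop back)) ℕ.+ F.rate) ℕ.* x)
                              ((go ++ (copies x (t ∷ Z) ++ back)) ++ F.W x)
      dips x 1≤x = subst (λ k → Dip k ((go ++ (copies x (t ∷ Z) ++ back)) ++ F.W x)) eq
        (dip-++ (dip-++ (scaled go) (dip-++ (dip-copies-* (dip-drop (t ∷ Z)) x) (scaled back)))
                (F.W-dip x 1≤x))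
        where
        -- The detour has constant cost; `1 ≤ x` is what absorbs it into a multiple of `x`.
        scaled : ∀ V → Dip (drop V ℕ.* x) V
        scaled V = dip-mono (ℕ.m≤m*n (drop V) x {{ℕ.>-nonZero 1≤x}}) (dip-drop V)
        eq : (drop go ℕ.* x ℕ.+ (drop (t ∷ Z) ℕ.* x ℕ.+ drop back ℕ.* x)) ℕ.+ F.rate ℕ.* x
             ≡ ((drop go ℕ.+ (drop (t ∷ Z) ℕ.+ drop back)) ℕ.+ F.rate) ℕ.* x
        eq = distrib (drop go) (drop (t ∷ Z)) (drop back) F.rate x
          where
          distrib : ∀ a b c e x → (a ℕ.* x ℕ.+ (b ℕ.* x ℕ.+ c ℕ.* x)) ℕ.+ e ℕ.* x ≡ ((a ℕ.+ (b ℕ.+ c)) ℕ.+ e) ℕ.* x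
          distrib = ℕ-solve-∀
      effs : ∀ x i → eff ((go ++ (copies x (t ∷ Z) ++ back)) ++ F.W x) i ≡
                     + x ℤ.* eff (t ∷ Z ++ R) i ℤ.+ eff ((go ++ back) ++ F.σ) i
      effs x i = begin
        E ((go ++ (copies x (t ∷ Z) ++ back)) ++ F.W x)
          ≡⟨ total-++ f (go ++ (copies x (t ∷ Z) ++ back)) (F.W x) ⟩
        E (go ++ (copies x (t ∷ Z) ++ back)) ℤ.+ E (F.W x)
          ≡⟨ cong₂ ℤ._+_ (trans (total-++ f go _) (cong (λ z → E go ℤ.+ z)
               (trans (total-++ f (copies x (t ∷ Z)) back) (cong (ℤ._+ E back) (total-copies f x (t ∷ Z))))))
               (F.W-eff x i) ⟩
        (E go ℤ.+ (+ x ℤ.* E (t ∷ Z) ℤ.+ E back)) ℤ.+ (+ x ℤ.* E R ℤ.+ E F.σ)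
          ≡⟨ regroup (E go) (+ x) (E (t ∷ Z)) (E back) (E R) (E F.σ) ⟩
        + x ℤ.* (E (t ∷ Z) ℤ.+ E R) ℤ.+ ((E go ℤ.+ E back) ℤ.+ E F.σ)
          ≡⟨ cong₂ (λ y z → + x ℤ.* y ℤ.+ z) (total-++ f (t ∷ Z) R)
               (trans (total-++ f (go ++ back) F.σ) (cong (ℤ._+ E F.σ) (total-++ f go back))) ⟨
        + x ℤ.* E (t ∷ Z ++ R) ℤ.+ E ((go ++ back) ++ F.σ) ∎
        where
        open ≡-Reasoning
        f = λ t → upd t i
        E = total f
        regroup : ∀ g x c b r s → (g ℤ.+ (x ℤ.* c ℤ.+ b)) ℤ.+ (x ℤ.* r ℤ.+ s) ≡
                                  x ℤ.* (c ℤ.+ r) ℤ.+ ((g ℤ.+ b) ℤ.+ s)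
        regroup = solve-∀

    Family-resp : ∀ {p a b} → a ≗ b → Family U p a → Family U p b
    Family-resp a≗b F = record
      { Family F ; W-eff = λ x i → trans (Family.W-eff F x i) (cong (λ z → + x ℤ.* z ℤ.+ _) (a≗b i)) }

    -- `closeUp` completes the first transition to a cycle inside `R`. A cycle has zero balance, so
    -- the remainder is balanced again and shorter.
    family : ∀ {p} n R → length R ≤ n → p ∈ states B → All (_∈ U) R → (∀ z → bal R z ≡ 0ℤ) →
             Family U p (eff R)
    family n       []      len       p∈B R⊆U balR = Family-[]
    family (suc n) (t ∷ R) (s≤s len) p∈B (t∈U ∷ R⊆U) balR
      with closeUp n R len R⊆U (src t) (tgt t)
             (λ z → bal-tail (ind (src t) z) (ind (tgt t) z) (bal R z) (balR z))
      where
      bal-tail : ∀ a b c → (b ℤ.- a) ℤ.+ c ≡ 0ℤ → c ≡ a ℤ.- b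
      bal-tail a b c eq = trans (split a b c) (trans (cong (ℤ._+ (a ℤ.- b)) eq) (ℤ.+-identityˡ _))
        where
        split : ∀ a b c → c ≡ ((b ℤ.- a) ℤ.+ c) ℤ.+ (a ℤ.- b)
        split = solve-∀
    ... | Z , R′ , walkZ , R↭ =
      Family-resp (λ i → sym (total-↭ (λ u → upd u i) (↭.prep t R↭)))
        (Family-cycle t Z R′ p∈B cycle (family n R′ len′ p∈B R′⊆U balR′))
      where
      cycle : Walk U (src t) (t ∷ Z) (src t)
      cycle = t∈U ∷ walkZ
      R′⊆U = All.++⁻ʳ Z (↭.All-resp-↭ R↭ R⊆U)
      len′ : length R′ ≤ n
      len′ = ℕ.≤-trans (ℕ.≤-trans (ℕ.m≤n+m (length R′) (length Z))
               (ℕ.≤-reflexive (sym (trans (↭.↭-length R↭) (List.length-++ Z))))) len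
      balR′ : ∀ z → bal R′ z ≡ 0ℤ
      balR′ z = begin
        bal R′ z                          ≡⟨ ℤ.+-identityˡ _ ⟨
        0ℤ ℤ.+ bal R′ z                   ≡⟨ cong (ℤ._+ bal R′ z) (trans (walk-bal cycle z) (ℤ.+-inverseʳ (ind (src t) z))) ⟨
        bal (t ∷ Z) z ℤ.+ bal R′ z        ≡⟨ total-++ (λ u → flow u z) (t ∷ Z) R′ ⟨
        bal (t ∷ Z ++ R′) z               ≡⟨ total-↭ (λ u → flow u z) (↭.prep t R↭) ⟨
        bal (t ∷ R) z                     ≡⟨ balR z ⟩
        0ℤ                                ∎
        where open ≡-Reasoning

    -- `Path` is nonempty by definition, so strong connectivity yields a closed walk of length at
    -- least 1 even from a state to itself. Its `x`-fold repetition has linear length.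
    pump-1 : Pump B 1
    pump-1 = record
      { base = p ; base∈ = p∈B ; π = π ; π-closed = πs
      ; W = λ x → copies x π ; W-closed = λ x → walk-copies x πs
      ; rate = drop π ; W-dip = λ x _ → dip-copies-* (dip-drop π) x
      ; W-eff = λ x i → ℤ.≤-reflexive (sym (total-copies _ x π))
      ; W-length = λ x → ℕ.≤-trans (ℕ.*-monoʳ-≤ x 1≤π) (ℕ.≤-reflexive (sym (length-copies x π)))
      }
      where
      p   = proj₁ (proj₁ (proj₂ sc))
      p∈B = proj₂ (proj₁ (proj₂ sc))
      π   = proj₁ (connect p∈B p∈B)
      πs  = proj₁ (proj₂ (connect p∈B p∈B))
      1≤π = proj₂ (proj₂ (connect p∈B p∈B))

    pump-suc : ∀ {C j} → states C ⊆ states B → transs C ⊆ transs B →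
               (∀ {t} → t ∈ transs C → Compensated U [ t ]) → Pump C j → Pump B (suc j)
    pump-suc {C} {j} C⊆B C⊆ᵗB comp P = record
      -- Each round has effect at least `eff F.σ`, independently of `x`, so `F.σ` is the fixed walk
      -- with which `x` rounds are compared.
      { base = P.base ; base∈ = base∈B ; π = F.σ ; π-closed = F.σ-closed
      ; W = λ x → copies x (round x)
      ; W-closed = λ x → walk-copies x (walk-++ (walk-mono C⊆ᵗB (P.W-closed x)) (F.W-closed x))
      ; rate = (P.rate ℕ.+ F.rate) ℕ.+ drop F.σ
      ; W-dip = dips
      ; W-eff = λ x i → subst (+ x ℤ.* eff F.σ i ℤ.≤_) (sym (total-copies _ x (round x)))
                          (ℤ.*-monoˡ-≤-nonNeg (+ x) (round-eff x i))
      ; W-length = λ x → ℕ.≤-trans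
          (ℕ.*-monoʳ-≤ x (ℕ.≤-trans (P.W-length x)
            (ℕ.≤-trans (ℕ.m≤m+n _ (length (F.W x))) (ℕ.≤-reflexive (sym (List.length-++ (P.W x)))))))
          (ℕ.≤-reflexive (sym (length-copies x (round x))))
      }
      where
      module P = Pump P
      base∈B = C⊆B P.base∈
      compensated = compensate (All.map comp (walk-all P.π-closed))
      R    = proj₁ compensated
      R⊆U  = proj₁ (proj₂ compensated)
      balπR = proj₁ (proj₂ (proj₂ compensated))
      effπR = proj₂ (proj₂ (proj₂ compensated))
      -- `P.π` is closed and hence balanced by itself, so `R` alone must be balanced.
      balR : ∀ z → bal R z ≡ 0ℤ
      balR z = begin
        bal R z                   ≡⟨ ℤ.+-identityˡ _ ⟨
        0ℤ ℤ.+ bal R z            ≡⟨ cong (ℤ._+ bal R z) (trans (walk-bal P.π-closed z) (ℤ.+-inverseʳ (ind P.base z))) ⟨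
        bal P.π z ℤ.+ bal R z     ≡⟨ balπR z ⟩
        0ℤ                        ∎
        where open ≡-Reasoning
      F : Family U P.base (eff R)
      F = family (length R) R ℕ.≤-refl base∈B R⊆U balR
      module F = Family F
      round : ℕ → List Trans
      round x = P.W x ++ F.W x
      -- `P.W x` gains at least `x` times `eff P.π`, `F.W x` gains exactly `x` times `eff R` plus
      -- `eff F.σ`, and `eff P.π + eff R` is nonnegative.
      round-eff : ∀ x i → eff F.σ i ℤ.≤ eff (round x) i
      round-eff x i = begin
        eff F.σ i
          ≡⟨ ℤ.+-identityˡ _ ⟨
        0ℤ ℤ.+ eff F.σ i
          ≤⟨ ℤ.+-monoˡ-≤ (eff F.σ i) (0≤i*j {+ x} (ℤ.+≤+ z≤n) (effπR i)) ⟩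
        + x ℤ.* (eff P.π i ℤ.+ eff R i) ℤ.+ eff F.σ i
          ≡⟨ expand (+ x) (eff P.π i) (eff R i) (eff F.σ i) ⟩
        + x ℤ.* eff P.π i ℤ.+ (+ x ℤ.* eff R i ℤ.+ eff F.σ i)
          ≤⟨ ℤ.+-mono-≤ (P.W-eff x i) (ℤ.≤-reflexive (sym (F.W-eff x i))) ⟩
        eff (P.W x) i ℤ.+ eff (F.W x) i
          ≡⟨ total-++ _ (P.W x) (F.W x) ⟨
        eff (round x) i ∎
        where
        open ℤ.≤-Reasoning
        expand : ∀ x a b c → x ℤ.* (a ℤ.+ b) ℤ.+ c ≡ x ℤ.* a ℤ.+ (x ℤ.* b ℤ.+ c)
        expand = solve-∀
      dips : ∀ x → 1 ≤ x → Dip (((P.rate ℕ.+ F.rate) ℕ.+ drop F.σ) ℕ.* x) (copies x (round x))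
      dips x 1≤x = subst (λ k → Dip k (copies x (round x))) (distrib P.rate F.rate (drop F.σ) x)
        -- The dip of a single round is already linear in `x`; every repetition adds at most the
        -- constant `drop F.σ`.
        (dip-copies (dip-++ (P.W-dip x 1≤x) (F.W-dip x 1≤x))
          (λ i → ℤ.≤-trans (dip-eff (dip-drop F.σ) i) (round-eff x i)) x)
        where
        distrib : ∀ a b c x → (a ℕ.* x ℕ.+ b ℕ.* x) ℕ.+ c ℕ.* x ≡ ((a ℕ.+ b) ℕ.+ c) ℕ.* x
        distrib = ℕ-solve-∀

-- Maximal quasi-ranking functions and duality

module Duality {d : ℕ} (A : VASS d) where
  open VASS A
  open Walks A
  open Pumping A

  module _ (B : SubVASS A) (f : LinMap A) where

    ∈-ranked⁺ : ∀ {t} → t ∈ transs B → Ranked A f t → t ∈ rankedSet A B f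
    ∈-ranked⁺ t∈B r = ∈-tabulate⁺ (λ t → (t ∈? transs B) ×-dec (_ ℚ.≤? _)) (t∈B , r)

    ∈-ranked⁻ : ∀ {t} → t ∈ rankedSet A B f → t ∈ transs B × Ranked A f t
    ∈-ranked⁻ = ∈-tabulate⁻ (λ t → (t ∈? transs B) ×-dec (_ ℚ.≤? _))

    ∈-neutral⁺ : ∀ {t} → t ∈ transs B → Neutral A f t → t ∈ neutralSet A B f
    ∈-neutral⁺ t∈B r = ∈-tabulate⁺ (λ t → (t ∈? transs B) ×-dec (_ ℚ.≟ _)) (t∈B , r)

    ∈-neutral⁻ : ∀ {t} → t ∈ neutralSet A B f → t ∈ transs B × Neutral A f t
    ∈-neutral⁻ = ∈-tabulate⁻ (λ t → (t ∈? transs B) ×-dec (_ ℚ.≟ _))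

  -- The change along `t` of the linear map with integer coefficients `c` and offsets `w`.
  drift : Vecℤ d → (Fin nQ → ℤ) → Trans → ℤ
  drift c w t = Dℤ.dot c (upd t) ℤ.+ (w (tgt t) ℤ.- w (src t))

  module _ (f : LinMap A) (c₁ : Vecℤ d) (w₁ : Fin nQ → ℤ) where

    perturb : LinMap A
    perturb = lin (λ i → c f i ℚ.+ ℤtoℚ (c₁ i)) (λ q → w f q ℚ.+ ℤtoℚ (w₁ q))

    private
      value : LinMap A → Trans → ℚ
      value g t = dotℚℤ (c g) (upd t) ℚ.+ w g (tgt t)

      value-perturb : ∀ t → value perturb t ≡ value f t ℚ.+ (ℤtoℚ (drift c₁ w₁ t) ℚ.+ ℤtoℚ (w₁ (src t)))
      value-perturb t = begin
        dotℚℤ (c perturb) (upd t) ℚ.+ (w f (tgt t) ℚ.+ ℤtoℚ (w₁ (tgt t)))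
          ≡⟨ cong (ℚ._+ _) dot-perturb ⟩
        (dotℚℤ (c f) (upd t) ℚ.+ ℤtoℚ (Dℤ.dot c₁ (upd t))) ℚ.+ (w f (tgt t) ℚ.+ ℤtoℚ (w₁ (tgt t)))
          ≡⟨ solve 4 (λ a b c e → (a :+ b) :+ (c :+ e) := (a :+ c) :+ (b :+ e)) refl
               (dotℚℤ (c f) (upd t)) (ℤtoℚ (Dℤ.dot c₁ (upd t))) (w f (tgt t)) (ℤtoℚ (w₁ (tgt t))) ⟩
        value f t ℚ.+ (ℤtoℚ (Dℤ.dot c₁ (upd t)) ℚ.+ ℤtoℚ (w₁ (tgt t)))
          ≡⟨ cong (value f t ℚ.+_) (trans (sym (ℤtoℚ-+ (Dℤ.dot c₁ (upd t)) (w₁ (tgt t)))) (trans (cong ℤtoℚ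
               (regroup (Dℤ.dot c₁ (upd t)) (w₁ (tgt t)) (w₁ (src t)))) (ℤtoℚ-+ (drift c₁ w₁ t) (w₁ (src t))))) ⟩
        value f t ℚ.+ (ℤtoℚ (drift c₁ w₁ t) ℚ.+ ℤtoℚ (w₁ (src t))) ∎
        where
        open ≡-Reasoning
        open +-*-Solver
        regroup : ∀ a b c → a ℤ.+ b ≡ (a ℤ.+ (b ℤ.- c)) ℤ.+ c
        regroup = solve-∀
        dot-perturb : dotℚℤ (c perturb) (upd t) ≡ dotℚℤ (c f) (upd t) ℚ.+ ℤtoℚ (Dℤ.dot c₁ (upd t))
        dot-perturb = begin
          dotℚℤ (c perturb) (upd t)
            ≡⟨ Dℚ.sum-cong-≗ (λ i → ℚ.*-distribʳ-+ (ℤtoℚ (upd t i)) (c f i) (ℤtoℚ (c₁ i))) ⟩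
          Dℚ.sum (λ i → c f i ℚ.* ℤtoℚ (upd t i) ℚ.+ ℤtoℚ (c₁ i) ℚ.* ℤtoℚ (upd t i))
            ≡⟨ Dℚ.∑-distrib-+ (λ i → c f i ℚ.* ℤtoℚ (upd t i)) _ ⟩
          dotℚℤ (c f) (upd t) ℚ.+ dotℚℤ (ℤtoℚ ∘ c₁) (upd t)
            ≡⟨ cong (dotℚℤ (c f) (upd t) ℚ.+_) (dotℚℤ-ℤtoℚ c₁ (upd t)) ⟩
          dotℚℤ (c f) (upd t) ℚ.+ ℤtoℚ (Dℤ.dot c₁ (upd t)) ∎

      -- `a` is the change guaranteed by `f` and `D` bounds that of the perturbation. The two uses
      -- split the required -1 as -1 + 0 and as 0 + -1.
      decrease : ∀ t {a D} → value f t ℚ.≤ w f (src t) ℚ.+ a → ℤtoℚ (drift c₁ w₁ t) ℚ.≤ D →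
                 a ℚ.+ D ≡ ℚ.- 1ℚ → Ranked A perturb t
      decrease t {a} {D} val≤ drift≤ a+D≡-1 = begin
        value perturb t
          ≡⟨ value-perturb t ⟩
        value f t ℚ.+ (ℤtoℚ (drift c₁ w₁ t) ℚ.+ ℤtoℚ (w₁ (src t)))
          ≤⟨ ℚ.+-mono-≤ val≤ (ℚ.+-monoˡ-≤ (ℤtoℚ (w₁ (src t))) drift≤) ⟩
        (w f (src t) ℚ.+ a) ℚ.+ (D ℚ.+ ℤtoℚ (w₁ (src t)))
          ≡⟨ solve 4 (λ s a D v → (s :+ a) :+ (D :+ v) := (s :+ v) :+ (a :+ D)) refl (w f (src t)) a D (ℤtoℚ (w₁ (src t))) ⟩
        (w f (src t) ℚ.+ ℤtoℚ (w₁ (src t))) ℚ.+ (a ℚ.+ D)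
          ≡⟨ cong (w perturb (src t) ℚ.+_) a+D≡-1 ⟩
        w perturb (src t) ℚ.- 1ℚ ∎
        where
        open ℚ.≤-Reasoning
        open +-*-Solver

    ranked-perturb : ∀ {t} → Ranked A f t → drift c₁ w₁ t ℤ.≤ 0ℤ → Ranked A perturb t
    ranked-perturb {t} r δ≤0 = decrease t r (ℤtoℚ-mono-≤ δ≤0) refl

    -- Integrality of the perturbation is what makes a negative drift at most -1.
    neutral-perturb-< : ∀ {t} → Neutral A f t → drift c₁ w₁ t ℤ.< 0ℤ → Ranked A perturb t
    neutral-perturb-< {t} n δ<0 =
      decrease t {a = 0ℚ} (ℚ.≤-reflexive (trans n (sym (ℚ.+-identityʳ _)))) (ℤtoℚ-mono-≤ (ℤ.i<j⇒i≤pred[j] δ<0)) refl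

    neutral-perturb-≡ : ∀ {t} → Neutral A f t → drift c₁ w₁ t ≡ 0ℤ → Neutral A perturb t
    neutral-perturb-≡ {t} n δ≡0 = trans (value-perturb t) (cong₂ ℚ._+_ n
      (trans (cong (λ z → ℤtoℚ z ℚ.+ ℤtoℚ (w₁ (src t))) δ≡0) (ℚ.+-identityˡ _)))

  -- Adding `(c₁ , w₁)` to `f` keeps every ranked transition ranked and ranks `t₀` as well. The
  -- ranked set would grow strictly, against maximality.
  no-improvement : ∀ {B f t₀} → IsMaxQRF A B f → t₀ ∈ neutralSet A B f → ∀ c₁ w₁ →
                   (∀ i → 0ℤ ℤ.≤ c₁ i) → (∀ t → t ∈ transs B → drift c₁ w₁ t ℤ.≤ 0ℤ) →
                   ¬ (drift c₁ w₁ t₀ ℤ.< 0ℤ)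
  no-improvement {B} {f} {t₀} ((0≤c , rn) , max) t₀∈ c₁ w₁ 0≤c₁ drift≤0 drift<0 =
    contradiction (max g (0≤cg , rng)) (ℕ.<⇒≱ (p⊂q⇒∣p∣<∣q∣
      ( (λ t∈ → let t∈B , r = ∈-ranked⁻ B f t∈ in ∈-ranked⁺ B g t∈B (ranked-perturb f c₁ w₁ r (drift≤0 _ t∈B)))
      , t₀ , ∈-ranked⁺ B g t₀∈B (neutral-perturb-< f c₁ w₁ t₀-neutral drift<0)
      -- Strictness of the inclusion: a neutral transition cannot also be ranked by `f`.
      , λ t₀∈r → p≰p-1 _ (subst (ℚ._≤ _) t₀-neutral (proj₂ (∈-ranked⁻ B f t₀∈r))) )))
    where
    g = perturb f c₁ w₁
    t₀∈B = proj₁ (∈-neutral⁻ B f t₀∈)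
    t₀-neutral = proj₂ (∈-neutral⁻ B f t₀∈)
    0≤cg : ∀ i → 0ℚ ℚ.≤ c g i
    0≤cg i = ℚ.+-mono-≤ (0≤c i) (ℤtoℚ-mono-≤ (0≤c₁ i))
    rng : ∀ t → t ∈ transs B → Ranked A g t ⊎ Neutral A g t
    rng t t∈B with rn t t∈B | drift c₁ w₁ t ℤ.≟ 0ℤ
    ... | inj₁ r | _       = inj₁ (ranked-perturb f c₁ w₁ r (drift≤0 t t∈B))
    ... | inj₂ n | yes δ≡0 = inj₂ (neutral-perturb-≡ f c₁ w₁ n δ≡0)
    ... | inj₂ n | no δ≢0  = inj₁ (neutral-perturb-< f c₁ w₁ n (ℤ.≤∧≢⇒< (drift≤0 t t∈B) δ≢0))

  module _ (U : Subset nT) where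

    -- ℕ-combinations of the rows of U and of the negated counter unit vectors: the
    -- coefficients of the former are the multiplicities in R, those of the latter the
    -- slack in ≤eff.
    record Cone (v : Vecℤ (d ℕ.+ nQ)) : Set where
      constructor cone
      field
        R    : List Trans
        R⊆U  : All (_∈ U) R
        bal≡ : ∀ z → v (d ↑ʳ z) ≡ bal R z
        ≤eff : ∀ i → v (i ↑ˡ nQ) ℤ.≤ eff R i

    cone-resp : ∀ {u v} → u ≗ v → Cone u → Cone v
    cone-resp u≗v (cone R R⊆U bal≡ ≤eff) =
      cone R R⊆U (λ z → trans (sym (u≗v _)) (bal≡ z)) λ i → subst (ℤ._≤ eff R i) (u≗v _) (≤eff i)

    cone-0 : Cone (λ _ → 0ℤ)
    cone-0 = cone [] [] (λ _ → refl) λ _ → ℤ.≤-refl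

    cone-+ : ∀ {u v} → Cone u → Cone v → Cone (λ j → u j ℤ.+ v j)
    cone-+ (cone R R⊆U balR effR) (cone S S⊆U balS effS) =
      cone (R ++ S) (All.++⁺ R⊆U S⊆U)
      (λ z → trans (cong₂ ℤ._+_ (balR z) (balS z)) (sym (total-++ _ R S)))
      λ i → ℤ.≤-trans (ℤ.+-mono-≤ (effR i) (effS i)) (ℤ.≤-reflexive (sym (total-++ _ R S)))

    open Farkas Cone cone-resp cone-0 cone-+

    row : Trans → Vecℤ (d ℕ.+ nQ)
    row t = upd t VF.++ flow t

    -- Transitions outside `U` get a zero row, which constrains nothing; so the system can be
    -- tabulated over all of `Fin nT`.
    rowIn : Trans → Vecℤ (d ℕ.+ nQ)
    rowIn t with t ∈? U
    ... | yes _ = row t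
    ... | no  _ = λ _ → 0ℤ

    rowIn-∈ : ∀ {t} → t ∈ U → rowIn t ≡ row t
    rowIn-∈ {t} t∈U with t ∈? U
    ... | yes _   = refl
    ... | no  t∉U = contradiction t∈U t∉U

    -- The inequality `dot (negUnit i) x ≤ 0` expresses that the coefficient of counter `i` is
    -- nonnegative.
    negUnit : Fin d → Vecℤ (d ℕ.+ nQ)
    negUnit i = (λ j → ℤ.- ind i j) VF.++ (λ _ → 0ℤ)

    cone-row : ∀ {t} → t ∈ U → Cone (row t)
    cone-row {t} t∈U = cone [ t ] (t∈U ∷ [])
      (λ z → trans (VF.lookup-++ʳ (upd t) (flow t) z) (sym (ℤ.+-identityʳ _)))
      λ i → ℤ.≤-reflexive (trans (VF.lookup-++ˡ (upd t) (flow t) i) (sym (ℤ.+-identityʳ _)))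

    cone-rowIn : ∀ t → Cone (rowIn t)
    cone-rowIn t with t ∈? U
    ... | yes t∈U = cone-row t∈U
    ... | no  _   = cone-0

    cone-negUnit : ∀ i → Cone (negUnit i)
    cone-negUnit i = cone [] []
      (λ z → VF.lookup-++ʳ (λ j → ℤ.- ind i j) (λ _ → 0ℤ) z)
      λ j → ℤ.≤-trans (ℤ.≤-reflexive (VF.lookup-++ˡ (λ j → ℤ.- ind i j) (λ _ → 0ℤ) j))
                      (ℤ.neg-mono-≤ (0≤ind i j))

    dot-row : ∀ t x → Dℤ.dot (row t) x ≡ drift (λ i → x (i ↑ˡ nQ)) (λ q → x (d ↑ʳ q)) t
    dot-row t x = trans (dot-++ (upd t) (flow t) x)
      (cong₂ ℤ._+_ (Dℤ.dot-comm (upd t) (λ i → x (i ↑ˡ nQ))) (dot-ind-diff (tgt t) (src t) (λ q → x (d ↑ʳ q))))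

    dot-negUnit : ∀ i x → Dℤ.dot (negUnit i) x ≡ ℤ.- x (i ↑ˡ nQ)
    dot-negUnit i x = trans (dot-++ (λ j → ℤ.- ind i j) (λ _ → 0ℤ) x)
      (trans (cong₂ ℤ._+_ (trans (dot-neg (ind i) (λ j → x (j ↑ˡ nQ))) (cong ℤ.-_ (dot-ind i (λ j → x (j ↑ˡ nQ)))))
                           (dot-zeroˡ (λ q → x (d ↑ʳ q)))) (ℤ.+-identityʳ _))

    cone-negRow : ∀ t → Cone (λ j → ℤ.- row t j) → Compensated U [ t ]
    cone-negRow t (cone R R⊆U balR effR) = R , R⊆U , bal≡ , ≤eff
      where
      bal≡ : ∀ z → bal [ t ] z ℤ.+ bal R z ≡ 0ℤ
      bal≡ z = trans (cong₂ ℤ._+_ (ℤ.+-identityʳ (flow t z))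
        (trans (sym (balR z)) (cong ℤ.-_ (VF.lookup-++ʳ (upd t) (flow t) z)))) (ℤ.+-inverseʳ (flow t z))
      ≤eff : ∀ i → 0ℤ ℤ.≤ eff [ t ] i ℤ.+ eff R i
      ≤eff i = begin
        0ℤ                                       ≡⟨ ℤ.+-inverseʳ (upd t i) ⟨
        upd t i ℤ.- upd t i                      ≡⟨ cong₂ ℤ._+_ (ℤ.+-identityʳ (upd t i)) (cong ℤ.-_ (VF.lookup-++ˡ (upd t) (flow t) i)) ⟨
        eff [ t ] i ℤ.- row t (i ↑ˡ nQ)          ≤⟨ ℤ.+-monoʳ-≤ (eff [ t ] i) (effR i) ⟩
        eff [ t ] i ℤ.+ eff R i                  ∎
        where open ℤ.≤-Reasoning

    -- Farkas' lemma applied to the negated row of `t₀`. A separating point is a pair `(c₁ , w₁)` of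
    -- coefficients and offsets; membership in the cone is a multiset that cancels the flow of `t₀`
    -- and offsets its effect.
    alternative : ∀ {t₀} → t₀ ∈ U →
      (∃[ c₁ ] ∃[ w₁ ] (∀ i → 0ℤ ℤ.≤ c₁ i) × (∀ t → t ∈ U → drift c₁ w₁ t ℤ.≤ 0ℤ) × drift c₁ w₁ t₀ ℤ.< 0ℤ)
      ⊎ Compensated U [ t₀ ]
    alternative {t₀} t₀∈U
      with farkas (Vec.tabulate rowIn Vec.++ Vec.tabulate negUnit)
                  (AllV.++⁺ (AllV.tabulate⁺ cone-rowIn) (AllV.tabulate⁺ cone-negUnit))
                  (λ j → ℤ.- row t₀ j)
    ... | inj₁ (x , rows≤0 , 0<γx) = inj₁
      ( (λ i → x (i ↑ˡ nQ)) , (λ q → x (d ↑ʳ q))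
      , (λ i → ℤ.neg-cancel-≤ (subst (ℤ._≤ 0ℤ) (dot-negUnit i x) (AllV.tabulate⁻ (proj₂ (AllV.++⁻ (Vec.tabulate rowIn) rows≤0)) i)))
      , (λ t t∈U → subst (ℤ._≤ 0ℤ) (trans (cong (λ r → Dℤ.dot r x) (rowIn-∈ t∈U)) (dot-row t x))
                     (AllV.tabulate⁻ (proj₁ (AllV.++⁻ (Vec.tabulate rowIn) rows≤0)) t))
      , ℤ.neg-cancel-< (subst (0ℤ ℤ.<_) (trans (dot-neg (row t₀) x) (cong ℤ.-_ (dot-row t₀ x))) 0<γx) )
    ... | inj₂ (+ zero , ℤ.+<+ () , _)
    ... | inj₂ (+ suc b , _ , k) = inj₂ (cone-negRow t₀
      (cone-resp (λ j → collapse (+ b) (row t₀ j)) (cone-+ k (K-*ℕ b (cone-row t₀∈U)))))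
      where
      collapse : ∀ b r → (1ℤ ℤ.+ b) ℤ.* (ℤ.- r) ℤ.+ b ℤ.* r ≡ ℤ.- r
      collapse = solve-∀

  neutral-compensated : ∀ {B f t} → IsMaxQRF A B f → t ∈ neutralSet A B f → Compensated (transs B) [ t ]
  neutral-compensated {B} {f} maxf t∈ with alternative (transs B) (proj₁ (∈-neutral⁻ B f t∈))
  ... | inj₂ comp = comp
  ... | inj₁ (c₁ , w₁ , 0≤c₁ , drift≤0 , drift<0) =
    contradiction drift<0 (no-improvement {B} {f} maxf t∈ c₁ w₁ 0≤c₁ drift≤0)

-- Decompositions

module Ranking {d : ℕ} (A : VASS d) where
  open VASS A
  open Walks A
  open Pumping A
  open Duality A

  private
    step-value : ∀ (f : LinMap A) t W q → dotℚℤ (c f) (eff (t ∷ W)) ℚ.+ w f q ≡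
                             dotℚℤ (c f) (upd t) ℚ.+ (dotℚℤ (c f) (eff W) ℚ.+ w f q)
    step-value f t W q = trans (cong (ℚ._+ w f q) (dotℚℤ-+ (c f) (upd t) (eff W)))
      (ℚ.+-assoc (dotℚℤ (c f) (upd t)) (dotℚℤ (c f) (eff W)) (w f q))

    empty-value : ∀ (f : LinMap A) q → dotℚℤ (c f) (eff []) ℚ.+ w f q ≡ w f q
    empty-value f q = trans (cong (ℚ._+ w f q) (dotℚℤ-0 (c f))) (ℚ.+-identityˡ (w f q))

  walk-neutral : ∀ {f U p W q} → (∀ t → t ∈ U → Neutral A f t) → Walk U p W q →
                 dotℚℤ (c f) (eff W) ℚ.+ w f q ≡ w f p
  walk-neutral {f} {p = p} neutral [] = empty-value f p
  walk-neutral {f} {q = q} neutral (_∷_ {t = t} {W = W} t∈U ws) = begin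
    dotℚℤ (c f) (eff (t ∷ W)) ℚ.+ w f q                       ≡⟨ step-value f t W q ⟩
    dotℚℤ (c f) (upd t) ℚ.+ (dotℚℤ (c f) (eff W) ℚ.+ w f q)   ≡⟨ cong (dotℚℤ (c f) (upd t) ℚ.+_) (walk-neutral {f} neutral ws) ⟩
    dotℚℤ (c f) (upd t) ℚ.+ w f (tgt t)                       ≡⟨ neutral t t∈U ⟩
    w f (src t)                                               ∎
    where open ≡-Reasoning

  ranked⇒≤ : ∀ {f t} → Ranked A f t ⊎ Neutral A f t →
             dotℚℤ (c f) (upd t) ℚ.+ w f (tgt t) ℚ.≤ w f (src t)
  ranked⇒≤ {f} {t} (inj₁ r) = ℚ.≤-trans r (ℚ.<⇒≤ (p-1<p (w f (src t))))
  ranked⇒≤ (inj₂ n) = ℚ.≤-reflexive n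

  walk-≤ : ∀ {f U p W q} → (∀ t → t ∈ U → Ranked A f t ⊎ Neutral A f t) → Walk U p W q →
           dotℚℤ (c f) (eff W) ℚ.+ w f q ℚ.≤ w f p
  walk-≤ {f} {p = p} rn [] = ℚ.≤-reflexive (empty-value f p)
  walk-≤ {f} {q = q} rn (_∷_ {t = t} {W = W} t∈U ws) = begin
    dotℚℤ (c f) (eff (t ∷ W)) ℚ.+ w f q                       ≡⟨ step-value f t W q ⟩
    dotℚℤ (c f) (upd t) ℚ.+ (dotℚℤ (c f) (eff W) ℚ.+ w f q)   ≤⟨ ℚ.+-monoʳ-≤ (dotℚℤ (c f) (upd t)) (walk-≤ {f} rn ws) ⟩
    dotℚℤ (c f) (upd t) ℚ.+ w f (tgt t)                       ≤⟨ ranked⇒≤ {f} (rn t t∈U) ⟩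
    w f (src t)                                               ∎
    where open ℚ.≤-Reasoning

  closed-neutral : ∀ {f U p W} → (∀ t → t ∈ U → Neutral A f t) → Walk U p W p → dotℚℤ (c f) (eff W) ≡ 0ℚ
  closed-neutral {f} {p = p} {W} neutral ws = begin
    D                         ≡⟨ solve 2 (λ D w → D := (D :+ w) :+ (:- w)) refl D (w f p) ⟩
    (D ℚ.+ w f p) ℚ.- w f p   ≡⟨ cong (ℚ._- w f p) (walk-neutral {f} neutral ws) ⟩
    w f p ℚ.- w f p           ≡⟨ ℚ.+-inverseʳ (w f p) ⟩
    0ℚ                        ∎
    where
    open ≡-Reasoning
    open +-*-Solver
    D = dotℚℤ (c f) (eff W)

  -- Around a closed walk the offsets `w f` cancel, so the product is the total change of `f`. The
  -- ranked `t` lowers `f` by at least 1 and `W` never raises it.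
  closed-ranked : ∀ {f U t W} → (∀ t → t ∈ U → Ranked A f t ⊎ Neutral A f t) → Ranked A f t →
                  Walk U (tgt t) W (src t) → dotℚℤ (c f) (eff (t ∷ W)) ≢ 0ℚ
  closed-ranked {f} {t = t} {W} rn r ws D≡0 = p≰p-1 (w f (src t)) (begin
    w f (src t)                                                         ≡⟨ ℚ.+-identityˡ (w f (src t)) ⟨
    0ℚ ℚ.+ w f (src t)                                                  ≡⟨ cong (ℚ._+ w f (src t)) D≡0 ⟨
    dotℚℤ (c f) (eff (t ∷ W)) ℚ.+ w f (src t)                           ≡⟨ step-value f t W (src t) ⟩
    dotℚℤ (c f) (upd t) ℚ.+ (dotℚℤ (c f) (eff W) ℚ.+ w f (src t))       ≤⟨ ℚ.+-monoʳ-≤ (dotℚℤ (c f) (upd t)) (walk-≤ {f} rn ws) ⟩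
    dotℚℤ (c f) (upd t) ℚ.+ w f (tgt t)                                 ≤⟨ r ⟩
    w f (src t) ℚ.- 1ℚ                                                  ∎)
    where open ℚ.≤-Reasoning

  ∃-ranked : ∀ {B f} → IsQRF A B f → ¬ (neutralSet A B f ≡ transs B) →
             ∃[ t ] t ∈ transs B × Ranked A f t
  ∃-ranked {B} {f} (_ , rn) neutral≢ with Fin.any? (λ t → (t ∈? transs B) ×-dec ¬? (t ∈? neutralSet A B f))
  ... | no ∄t = contradiction (⊆-antisym (λ t∈ → proj₁ (∈-neutral⁻ B f t∈))
                  (λ {t} t∈ → decidable-stable (t ∈? neutralSet A B f) (λ t∉ → ∄t (t , t∈ , t∉)))) neutral≢
  ... | yes (t , t∈B , t∉) with rn t t∈B
  ...   | inj₁ r = t , t∈B , r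
  ...   | inj₂ n = contradiction (∈-neutral⁺ B f t∈B n) t∉

  ClosedEffect : Subset nT → Vecℚ d → Set
  ClosedEffect U e = ∃[ p ] ∃[ W ] Walk U p W p × e ≡ ℤtoℚ ∘ eff W

  -- The invariant asks only that the effects come from closed walks in `B`: a function neutral on
  -- `B` is then orthogonal to all of them, which is what the next outer level needs.
  Independent : SubVASS A → ℕ → Set
  Independent B k = ∃[ L ] Triangular L × All (ClosedEffect (transs B) ∘ proj₂) L × length L ≡ k

  module _ {B f} (sc : StronglyConnected A B) (qrf : IsQRF A B f) (neutral≢ : ¬ (neutralSet A B f ≡ transs B)) where

    private
      ranked = ∃-ranked {B} {f} qrf neutral≢
      t      = proj₁ ranked
      t∈B    = proj₁ (proj₂ ranked)
      back   = connect sc (proj₂ (proj₁ sc t t∈B)) (proj₁ (proj₁ sc t t∈B))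
      W      = proj₁ back
      ws     = proj₁ (proj₂ back)
      e      = ℤtoℚ ∘ eff (t ∷ W)
      ce≢0 : Dℚ.dot (c f) e ≢ 0ℚ
      ce≢0 = closed-ranked {f} (proj₂ qrf) (proj₂ (proj₂ ranked)) ws
      closed : ClosedEffect (transs B) e
      closed = src t , t ∷ W , t∈B ∷ ws , refl

    independent-1 : Independent B 1
    independent-1 = (c f , e) ∷ [] , (ce≢0 , []) ∷ [] , closed ∷ [] , refl

    independent-suc : ∀ {C m} → transs C ⊆ neutralSet A B f → Independent C m → Independent B (suc m)
    independent-suc {C} C⊆ (L , tri , effs , len) =
      (c f , e) ∷ L , (ce≢0 , All.map orthogonal effs) ∷ tri , closed ∷ All.map widen effs , cong suc len
      where
      orthogonal : ∀ {e} → ClosedEffect (transs C) e → Dℚ.dot (c f) e ≡ 0ℚ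
      orthogonal (p , V , vs , refl) = closed-neutral {f} (λ t t∈C → proj₂ (∈-neutral⁻ B f (C⊆ t∈C))) vs
      widen : ∀ {e} → ClosedEffect (transs C) e → ClosedEffect (transs B) e
      widen (p , V , vs , eq) = p , V , walk-mono (λ t∈C → proj₁ (∈-neutral⁻ B f (C⊆ t∈C))) vs , eq

  decompose-independent : ∀ {B k} → StronglyConnected A B → Decompose A B (just k) → Independent B k
  decompose-independent sc (none-neutral f (qrf , _) neutral≢ _) = independent-1 {f = f} sc qrf neutral≢
  -- Neutral transitions without any SCC: the maximum is 0 and the value is 1, as in the case of no
  -- neutral transitions.
  decompose-independent sc (recurse-fin f _ (qrf , _) neutral≢ _ _ (inj₁ refl)) = independent-1 {f = f} sc qrf neutral≢
  decompose-independent sc (recurse-fin f _ (qrf , _) neutral≢ _ _ (inj₂ (C , (_ , C⊆ , scC , _) , dec))) =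
    independent-suc {f = f} sc qrf neutral≢ {C} C⊆ (decompose-independent scC dec)

  decompose-positive : ∀ {B k} → Decompose A B (just k) → 1 ≤ k
  decompose-positive (none-neutral _ _ _ _)        = s≤s z≤n
  decompose-positive (recurse-fin _ _ _ _ _ _ _)   = s≤s z≤n

  decompose-pump : ∀ {B k} → StronglyConnected A B → Decompose A B (just k) → Pump B k
  decompose-pump sc (none-neutral _ _ _ _)                  = pump-1 sc
  decompose-pump sc (recurse-fin _ _ _ _ _ _ (inj₁ refl))   = pump-1 sc
  -- The recursion follows an SCC at which the maximum is attained; its transitions are neutral for
  -- a maximal `f` and hence compensated in `B`.
  decompose-pump {B} sc (recurse-fin f _ maxf _ _ _ (inj₂ (C , (C⊆B , C⊆ , scC , _) , dec))) =
    pump-suc sc C⊆B (λ t∈C → proj₁ (∈-neutral⁻ B f (C⊆ t∈C)))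
      (λ t∈C → neutral-compensated {B} {f} maxf (C⊆ t∈C)) (decompose-pump scC dec)

  -- From pumps to computations and the asymptotic bound

  safe-computation : ∀ {U p W q} (v : Vecℕ d) → Walk U p W q → Safe (λ i → + v i) W → Computation A p v (length W)
  safe-computation v []                       safe        = done
  safe-computation v (_∷_ {t = t} {W = W} t∈U ws) (0≤ , safe) = step t refl v′ v′≡
    (safe-computation v′ ws (safe-mono (λ i → ℤ.≤-reflexive (sym (v′≡ i))) W safe))
    where
    v′ : Vecℕ d
    v′ i = ℤ.∣ + v i ℤ.+ upd t i ∣
    v′≡ : ∀ i → + v′ i ≡ + v i ℤ.+ upd t i
    v′≡ i = ℤ.0≤i⇒+∣i∣≡i (0≤ i)

-- Start with `n` in every counter and run `W x` for `x = n / r`. The dip fits because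
-- `rate * x ≤ n`, and `n ≤ 2 r x` gives `n ^ k ≤ (2 r) ^ k * x ^ k`. The threshold `r` ensures
-- `1 ≤ x`.
pump⇒Ω : ∀ {d} (A : VASS (suc d)) {B k} → Pumping.Pump A B k → 𝓛∈Ω[n^_] A k
pump⇒Ω {d} A {B} {k} P =
  let b , 0<b , bound = reciprocal ((2 ℕ.* r) ℕ.^ k) {{ℕ.m^n≢0 (2 ℕ.* r) k}} in
  b , 0<b , r , λ n r≤n →
    base , (λ _ → n) , max-const d n , length (W (n / r)) ,
    safe-computation (λ _ → n) (W-closed (n / r))
      (W-dip (n / r) (m≥n⇒m/n>0 r≤n) (λ _ → + n) (λ _ → ℤ.+≤+ (rate*x≤n n))) ,
    bound (n^k≤ n r≤n)
  where
  open Pumping.Pump P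
  open Ranking A
  -- The successor makes the divisor nonzero even when `rate` is 0.
  r = suc rate
  rate*x≤n : ∀ n → rate ℕ.* (n / r) ≤ n
  rate*x≤n n = begin
    rate ℕ.* (n / r) ≤⟨ ℕ.*-monoˡ-≤ (n / r) (ℕ.n≤1+n rate) ⟩
    r ℕ.* (n / r)    ≡⟨ ℕ.*-comm r (n / r) ⟩
    (n / r) ℕ.* r    ≤⟨ m/n*n≤m n r ⟩
    n                ∎
    where open ℕ.≤-Reasoning
  n^k≤ : ∀ n → r ≤ n → n ℕ.^ k ≤ (2 ℕ.* r) ℕ.^ k ℕ.* length (W (n / r))
  n^k≤ n r≤n = begin
    n ℕ.^ k                                        ≤⟨ ℕ.^-monoˡ-≤ k (n≤2c[n/c] r n r≤n) ⟩
    ((2 ℕ.* r) ℕ.* (n / r)) ℕ.^ k                  ≡⟨ ^-distribʳ-* (2 ℕ.* r) (n / r) k ⟩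
    (2 ℕ.* r) ℕ.^ k ℕ.* (n / r) ℕ.^ k              ≤⟨ ℕ.*-monoʳ-≤ ((2 ℕ.* r) ℕ.^ k) (W-length (n / r)) ⟩
    (2 ℕ.* r) ℕ.^ k ℕ.* length (W (n / r))         ∎
    where open ℕ.≤-Reasoning

mainTheorem6 : (d : ℕ) (A : VASS d) → IsStronglyConnectedVASS A →
    NonZero (VASS.nT A) →
    (k : ℕ) (tight : Bool) → Algorithm1 A (just (k , tight)) →
    (1 ≤ k × k ≤ d) × 𝓛∈Ω[n^_] A k
mainTheorem6 d A sc _ k tight (result _ _ _ dec) = (1≤k , k≤d) , lower d A sc dec (ℕ.≤-trans 1≤k k≤d)
  where
  1≤k = Ranking.decompose-positive A dec
  independent = Ranking.decompose-independent A sc dec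
  k≤d : k ≤ d
  k≤d = let L , tri , _ , len = independent in subst (_≤ d) len (triangular-length d L tri)
  -- The dimension must be positive: the empty vector has size 0, so in dimension 0 there is no
  -- configuration of size `n > 0`. It is positive because `1 ≤ k ≤ d`.
  lower : ∀ d (A : VASS d) → StronglyConnected A (whole A) → Decompose A (whole A) (just k) →
          1 ≤ d → 𝓛∈Ω[n^_] A k
  lower (suc d) A sc dec _ = pump⇒Ω A (Ranking.decompose-pump A sc dec)
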